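{- (Type $A$.) Let $k\geq1$ and $m\geq 2k+2$ be integers, $n=m-2k-1$, $W=\mathfrak S_{n+1}$ of type $A_n$ with generators $s_i=(i\ i+1)$, $c$ a Coxeter element with reduced word $\mathbf{c}$, $Q=\mathbf{c}^k\mathbf{w}_\circ(\mathbf{c})$, and $\varphi_A$ the bijection below from positions of $Q$ to $k$-relevant diagonals of a convex $m$-gon. Then for every position $q$ of $Q$, $\varphi_A(\Theta(q))$ is obtained from $\varphi_A(q)$ by rotating one step clockwise (i.e. $[a,b]\mapsto[a+1,b+1]$ mod $m$). (Type $B$.) Let $k\geq1$ and $m>k$ be integers, $n=m-k$, $W$ of type $B_n$ with generators $s_1,\dots,s_n$ where $(s_1s_2)^4=1$, $(s_is_{i+1})^3=1$ for $1<i<n$, and all other pairs of distinct generators commute, $c$ a Coxeter element with reduced word $\mathbf{c}$, $Q=\mathbf{c}^k\mathbf{w}_\circ(\mathbf{c})$, and $\varphi_B$ the bijection below from positions of $Q$ to symmetric pairs of $k$-relevant diagonals of a regular $2m$-gon. Then for every position $q$ of $Q$, $\varphi_B(\Theta(q))$ is obtained from $\varphi_B(q)$ by rotating one step clockwise (adding $1$ mod $2m$ to all endpoints).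
   Context: $w_\circ$ is the longest element, $\psi(s)=w_\circ^{ -1}sw_\circ$, and $\mathbf{w}_\circ(\mathbf{c})$ is the lexicographically first (as a sequence of positions) subword of $\mathbf{c}\mathbf{c}\cdots$ which is a reduced expression for $w_\circ$. For $Q=(q_1,\dots,q_r)$, $\Theta$ sends a position $i$ with $q_i=s$ to the next position $j>i$ with $q_j=s$ if it exists, and otherwise to the first position $j$ with $q_j=\psi(s)$. A diagonal of a polygon is $k$-relevant if at least $k$ polygon vertices lie strictly on each side of it. For $i\in\{1,\dots,n\}$ let $p_i$ be the position of $s_i$ in $\mathbf{c}$. Type $A$: label the vertices of the convex $m$-gon $0,\dots,m-1$ clockwise; set $a_i=|\{j<i: p_j<p_{j+1}\}| \bmod m$ and $b_i=-k-1-|\{j<i:p_j>p_{j+1}\}| \bmod m$; $\varphi_A$ sends the $\ell$-th occurrence of $s_i$ in $Q$ to the diagonal obtained by rotating $[a_i,b_i]$ clockwise $\ell-1$ times; this is a bijection onto the $k$-relevant diagonals. Type $B$: label the vertices of the regular $2m$-gon $0,\dots,2m-1$ clockwise; a symmetric pair is an orbit $\{[a,b],[a+m,b+m]\}$ (indices mod $2m$) of a $k$-relevant diagonal under central symmetry (a single diagonal for diameters); set $a_i=|\{j<i:p_j<p_{j+1}\}|$ and $b_i=m-|\{j<i:p_j>p_{j+1}\}|$; $\varphi_B$ sends the $\ell$-th occurrence of $s_i$ in $Q$ to the symmetric pair obtained by rotating $\{[a_i,b_i],[a_i+m,b_i+m]\}$ clockwise $\ell-1$ times; this is a bijection onto the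 symmetric pairs of $k$-relevant diagonals. -}

module Defs where

open import Data.Nat as ℕ using (ℕ; zero; suc; _+_; _*_; _<_; _≤_; NonZero)
open import Data.Nat.DivMod using (_mod_)
open import Data.Fin as Fin using (Fin; zero; suc; toℕ; inject₁)
open import Data.Bool using (Bool; true; false; not; if_then_else_)
open import Data.Product using (_×_; _,_; map₁)
open import Data.Product.Properties using () renaming (≡-dec to ×-≡-dec)
open import Data.Sum using (_⊎_)
open import Data.List as List using (List; []; _∷_; _++_; length; map; reverse; filter; concat; replicate; allFin; lookup; upTo)
open import Data.Vec as Vec using (Vec)
open import Data.Vec.Properties using () renaming (≡-dec to vec-≡-dec)
import Data.Bool.Properties as BoolP
open import Data.Integer as ℤ using (ℤ; +_)
open import Data.Integer.Divisibility using () renaming (_∣_ to _∣ℤ_)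
open import Relation.Binary.PropositionalEquality using (_≡_)
open import Relation.Binary.Definitions using (DecidableEquality)
open import Relation.Nullary using (does)
open import Relation.Nullary.Decidable using (_×-dec_)

swapVec : ∀ {A : Set} {n} → Fin n → Fin n → Vec A n → Vec A n
swapVec i j v = Vec.tabulate λ x →
  if does (x Fin.≟ i) then Vec.lookup v j
  else if does (x Fin.≟ j) then Vec.lookup v i
  else Vec.lookup v x

-- Type A_n : W = S_{n+1}.  Generator index t : Fin n stands for
-- s_{t+1} = (t+1  t+2).  Group elements are permutations in one-line
-- notation (Vec (Fin (suc n)) (suc n)); right multiplication by s_{t+1}
-- swaps the entries in positions t and t+1.

GA : ℕ → Set
GA n = Vec (Fin (suc n)) (suc n)

actA : ∀ {n} → GA n → Fin n → GA n
actA w t = swapVec (inject₁ t) (suc t) w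

evA : ∀ {n} → List (Fin n) → GA n
evA {n} = List.foldl actA (Vec.allFin (suc n))

decGA : ∀ {n} → DecidableEquality (GA n)
decGA = vec-≡-dec Fin._≟_

-- Type B_n : signed permutations of {±1,…,±n}.  Index zero stands for
-- s_1 (sign change of the first coordinate), index suc t' stands for
-- s_{t'+2} (transposition of coordinates t'+1 and t'+2).  Thus
-- (s_1 s_2)^4 = 1, (s_i s_{i+1})^3 = 1 for 1<i<n, others commute.
-- An element w is stored as the vector (w(1),…,w(n)), each entry a pair
-- (negative?, absolute value − 1).

GB : ℕ → Set
GB n = Vec (Bool × Fin n) n

actB : ∀ {n} → GB n → Fin n → GB n
actB {suc n} w zero    = Vec.updateAt w zero (map₁ not)
actB {suc n} w (suc t) = swapVec (inject₁ t) (suc t) w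

evB : ∀ {n} → List (Fin n) → GB n
evB {n} = List.foldl actB (Vec.tabulate (λ j → (false , j)))

decGB : ∀ {n} → DecidableEquality (GB n)
decGB = vec-≡-dec (×-≡-dec BoolP._≟_ Fin._≟_)

data _≤lex_ : List ℕ → List ℕ → Set where
  []≤   : ∀ {ys} → [] ≤lex ys
  here  : ∀ {x y xs ys} → x < y → (x ∷ xs) ≤lex (y ∷ ys)
  there : ∀ {x xs ys} → xs ≤lex ys → (x ∷ xs) ≤lex (x ∷ ys)

data Increasing : List ℕ → Set where
  []  : Increasing []
  [-] : ∀ {x} → Increasing (x ∷ [])
  _∷_ : ∀ {x y xs} → x < y → Increasing (y ∷ xs) → Increasing (x ∷ y ∷ xs)

_≡[mod_]_ : ℤ → ℕ → ℤ → Set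
x ≡[mod m ] y = (+ m) ∣ℤ (x ℤ.- y)

-- A diagonal [a,b] given by two integer endpoint labels (read mod m).
Diag : Set
Diag = ℤ × ℤ

SameDiag : ℕ → Diag → Diag → Set
SameDiag m (a , b) (a' , b') =
  ((a ≡[mod m ] a') × (b ≡[mod m ] b')) ⊎ ((a ≡[mod m ] b') × (b ≡[mod m ] a'))

rot : Diag → Diag
rot (a , b) = (a ℤ.+ + 1 , b ℤ.+ + 1)

rotBy : ℕ → Diag → Diag
rotBy r (a , b) = (a ℤ.+ + r , b ℤ.+ + r)

-- A symmetric pair {[a,b],[a+m,b+m]} in the 2m-gon is represented by
-- either of its diagonals; two representatives give the same symmetric
-- pair iff the second diagonal equals one of the two diagonals of the first.
SameSymPair : ℕ → Diag → Diag → Set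
SameSymPair m d d' = SameDiag (2 * m) d d' ⊎ SameDiag (2 * m) (rotBy m d) d'

-- Generic Coxeter-word notions, for a model ev : words → group elements
-- (ev [t₁,…,t_r] = s_{t₁}⋯s_{t_r}) with decidable equality.

cinf : ∀ {n} → .{{_ : NonZero n}} → Vec (Fin n) n → ℕ → Fin n
cinf {n} c p = Vec.lookup c (p mod n)

subword : ∀ {n} → .{{_ : NonZero n}} → Vec (Fin n) n → List ℕ → List (Fin n)
subword c ps = map (cinf c) ps

module Coxeter {n : ℕ} {G : Set} (ev : List (Fin n) → G)
               (_≟G_ : DecidableEquality G) where

  Reduced : List (Fin n) → Set
  Reduced ws = ∀ vs → ev vs ≡ ev ws → length ws ≤ length vs

  ReducedLongest : List (Fin n) → Set
  ReducedLongest ws = Reduced ws × (∀ vs → Reduced vs → length vs ≤ length ws)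

  WoCandidate : .{{_ : NonZero n}} → Vec (Fin n) n → List ℕ → Set
  WoCandidate c ps = Increasing ps × ReducedLongest (subword c ps)

  IsWoC : .{{_ : NonZero n}} → Vec (Fin n) n → List ℕ → Set
  IsWoC c ps = WoCandidate c ps × (∀ qs → WoCandidate c qs → ps ≤lex qs)

  -- ψ(s) = w∘⁻¹ s w∘, computed from a reduced word w0 of w∘
  -- (w∘⁻¹ = ev (reverse w0) since generators are involutions)
  ψ : List (Fin n) → Fin n → Fin n
  ψ w0 s with filter (λ t → ev (reverse w0 ++ s ∷ w0) ≟G ev (t ∷ [])) (allFin n)
  ... | t ∷ _ = t
  ... | []    = s

  Θ : (w0 Q : List (Fin n)) → Fin (length Q) → Fin (length Q)
  Θ w0 Q i with filter (λ j → (toℕ i ℕ.<? toℕ j) ×-dec (lookup Q j Fin.≟ lookup Q i)) (allFin (length Q))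
  ... | j ∷ _ = j
  ... | [] with filter (λ j → lookup Q j Fin.≟ ψ w0 (lookup Q i)) (allFin (length Q))
  ...   | j ∷ _ = j
  ...   | []    = i

-- p_{j+1} − 1 : the (0-based) position in c of the generator with index j
posC : ∀ {n} → Vec (Fin n) n → ℕ → ℕ
posC {n} c j with filter (λ i → toℕ (Vec.lookup c i) ℕ.≟ j) (allFin n)
... | i ∷ _ = toℕ i
... | []    = 0

-- for generator s_i (index t = i−1): |{ j < i : p_j < p_{j+1} }|
ascC : ∀ {n} → Vec (Fin n) n → Fin n → ℕ
ascC c t = length (filter (λ j → posC c j ℕ.<? posC c (suc j)) (upTo (toℕ t)))

descC : ∀ {n} → Vec (Fin n) n → Fin n → ℕ
descC c t = length (filter (λ j → posC c (suc j) ℕ.<? posC c j) (upTo (toℕ t)))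

-- ℓ − 1 where position q carries the ℓ-th occurrence of its letter in Q
occ : ∀ {n} (Q : List (Fin n)) → Fin (length Q) → ℕ
occ Q q = length (filter (λ j → (toℕ j ℕ.<? toℕ q) ×-dec (lookup Q j Fin.≟ lookup Q q)) (allFin (length Q)))

mkQ : ∀ {n} → .{{_ : NonZero n}} → ℕ → Vec (Fin n) n → List ℕ → List (Fin n)
mkQ k c ps = concat (replicate k (Vec.toList c)) ++ subword c ps

φA : ∀ {n} → ℕ → Vec (Fin n) n → (Q : List (Fin n)) → Fin (length Q) → Diag
φA k c Q q = rotBy (occ Q q) (+ ascC c t , ℤ.- (+ (suc k + descC c t)))
  where t = lookup Q q

φB : ∀ {n} → ℕ → Vec (Fin n) n → (Q : List (Fin n)) → Fin (length Q) → Diag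
φB m c Q q = rotBy (occ Q q) (+ ascC c t , + m ℤ.- + descC c t)
  where t = lookup Q q

{-# OPTIONS --safe #-}
module Submission where

-- Only the number of occurrences of each letter in w∘(c) matters.  Indexing the
-- generators from 0, with asc i and desc i the numbers of j < i with p_j < p_{j+1}
-- and p_j > p_{j+1}, these numbers are e i = 1 + desc i + asc (n − 1 − i) in type A
-- and e i = n in type B.  Read c c c ⋯ and keep the ℓ-th copy of s_i iff ℓ ≤ e i.
--
-- * The kept word represents w∘: draw it as a wiring diagram and label the two wires
--   that meet at the ℓ-th crossing of column i by asc i + ℓ − 1 and n − desc i + ℓ − 1
--   (the diagonals of φ for k = 0).  Consecutive crossings agree on the wire between
--   them, modulo n + 1 in type A, while in type B a sign change adds n.  Comparing the
--   first and last labels shows that the word reverses, respectively negates.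
-- * It is reduced, since Σ e i is the largest value of the length function.
-- * It is lexicographically first: when a copy of s_i is skipped no s_i is kept later,
--   so the prefix has already separated the large from the small values at position i,
--   that is, s_i is a descent of the prefix.
--
-- Hence s_i occurs k + e i times in Q, and rotating the first diagonal of s_i that
-- often gives the first diagonal of ψ(s_i).

open import Defs
open import Data.Nat using (ℕ; zero; suc; _+_; _*_; _∸_; _⊓_; _≤_; _<_; z≤n; s≤s; NonZero; ≢-nonZero⁻¹)
open import Data.Nat.Properties
open import Data.Nat.DivMod using (_/_; _%_; _mod_; /-monoˡ-≤; [m+n]%n≡m%n; [m+kn]%n≡m%n; m<n⇒m%n≡m; m<n⇒m/n≡0; m%n<n; m≡m%n+[m/n]*n; +-distrib-/-∣ʳ; m*n/n≡m; n/n≡1; n%n≡0; 0/n≡0; m*n%n≡0; m<n*o⇒m/o<n)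
open import Data.Nat.Divisibility using (n∣m*n; ∣-refl; _∣0) renaming (_∣_ to _∣ℕ_)
open import Data.Nat.Solver using (module +-*-Solver)
open import Algebra.Properties.CommutativeSemigroup +-commutativeSemigroup using (interchange)
open import Data.Integer as ℤ using (ℤ; -[1+_])
import Data.Integer.Properties as ℤₚ
open import Data.Fin as Fin using (Fin; zero; suc; toℕ; inject₁; fromℕ; opposite)
import Data.Fin.Properties as Finₚ
open import Data.Fin.Induction using (<-weakInduction)
open import Data.Bool using (Bool; true; false; not; if_then_else_)
import Data.Bool.Properties as Boolₚ
open import Data.List as List using (List; []; _∷_; _++_; _∷ʳ_; length; foldl; filter; tabulate; allFin; upTo; reverse; replicate; concat)
open import Data.List.Properties using (filter-++; filter-accept; filter-reject; length-++; length-map; map-++; ++-assoc; ++-identityʳ; foldl-++; foldl-∷ʳ; foldl-cong; unfold-reverse; tabulate-lookup; applyUpTo-∷ʳ; ∷-injectiveˡ)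
open import Data.Vec as Vec using (Vec; []; _∷_; lookup)
open import Data.Vec.Properties using (tabulate∘lookup; lookup∘tabulate; tabulate-cong; tabulate-∘; lookup-map)
open import Data.Product using (_×_; _,_; proj₁; proj₂; ∃; map₁)
open import Data.Sum using (_⊎_; inj₁; inj₂)
open import Data.Empty using (⊥; ⊥-elim)
open import Function using (_∘_; id)
open import Relation.Nullary using (¬_; Dec; yes; no; does)
open import Relation.Nullary.Decidable using (_×-dec_)
open import Relation.Unary using (Decidable)
open import Relation.Binary.Definitions using (DecidableEquality; tri<; tri≈; tri>)
open import Relation.Binary.PropositionalEquality

-- The numbers `e i` come from the conclusion. In type A, rotating the first diagonal of s_i until
-- its endpoint b_i reaches a_{ψ(i)} takes k + e i steps, and its other endpoint then lands on
-- b_{ψ(i)}; in type B, n + k steps are a half-turn and ψ is trivial. What has to be shown is that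
-- w∘(c) really has these letter counts. The obstacle is that the permutations along its prefixes
-- depend on c in an irregular way. Labels avoid describing them: how a label passes from one
-- crossing to the next depends only on two adjacent columns, so one local invariant per gap is
-- enough, and since the initial labels are distinct, the final ones determine the whole
-- permutation. Lengths are inversion counts, tied to word length by sorting along descents. The
-- given `ps` is compared with the selected positions only once: it is reduced and lexicographically
-- no larger, and reading both from left to right leaves it no place to differ.

private variable
  X Y : Set
  l : ℕ

-- Counting along tabulated lists

filter-tabulate-head : {P : X → Set} (P? : Decidable P) (f : Fin l → X) {y : X} {ys : List X} →
  filter P? (tabulate f) ≡ y ∷ ys →
  ∃ λ j → f j ≡ y × P (f j) × (∀ i → toℕ i < toℕ j → ¬ P (f i))
filter-tabulate-head {l = suc l} P? f eq with P? (f zero)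
... | yes p = zero , ∷-injectiveˡ eq , p , λ _ ()
... | no ¬p =
  let j , fj≡y , pj , before = filter-tabulate-head P? (f ∘ suc) eq in
  suc j , fj≡y , pj , λ { zero _ → ¬p ; (suc i) (s≤s i<j) → before i i<j }

filter-tabulate-[] : {P : X → Set} (P? : Decidable P) (f : Fin l → X) →
  filter P? (tabulate f) ≡ [] → ∀ i → ¬ P (f i)
filter-tabulate-[] {l = suc l} P? f eq i with P? (f zero)
filter-tabulate-[] {l = suc l} P? f eq zero    | no ¬p = ¬p
filter-tabulate-[] {l = suc l} P? f eq (suc i) | no ¬p = filter-tabulate-[] P? (f ∘ suc) eq i

filter-tabulate-none : {P : X → Set} (P? : Decidable P) (f : Fin l → X) →
  (∀ i → ¬ P (f i)) → filter P? (tabulate f) ≡ []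
filter-tabulate-none {l = zero}  P? f none = refl
filter-tabulate-none {l = suc l} P? f none with P? (f zero)
... | yes p = ⊥-elim (none zero p)
... | no  _ = filter-tabulate-none P? (f ∘ suc) (none ∘ suc)

length-filter-tabulate-cong : {P R : X → Set} (P? : Decidable P) (R? : Decidable R) (f : Fin l → X) →
  (∀ i → (P (f i) → R (f i)) × (R (f i) → P (f i))) →
  length (filter P? (tabulate f)) ≡ length (filter R? (tabulate f))
length-filter-tabulate-cong {l = zero}  P? R? f P⇔R = refl
length-filter-tabulate-cong {l = suc l} P? R? f P⇔R with P? (f zero) | R? (f zero)
... | yes p | yes r = cong suc (length-filter-tabulate-cong P? R? (f ∘ suc) (P⇔R ∘ suc))
... | no ¬p | no ¬r = length-filter-tabulate-cong P? R? (f ∘ suc) (P⇔R ∘ suc)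
... | yes p | no ¬r = ⊥-elim (¬r (proj₁ (P⇔R zero) p))
... | no ¬p | yes r = ⊥-elim (¬p (proj₂ (P⇔R zero) r))

-- Meant for occurrence counts: passing to the next copy of a letter adds exactly the index `q` to
-- the set that is counted.
length-filter-tabulate-insert : {P R : X → Set} (P? : Decidable P) (R? : Decidable R) (f : Fin l → X) (q : Fin l) →
  P (f q) → ¬ R (f q) → (∀ i → i ≢ q → (P (f i) → R (f i)) × (R (f i) → P (f i))) →
  length (filter P? (tabulate f)) ≡ suc (length (filter R? (tabulate f)))
length-filter-tabulate-insert {l = suc l} P? R? f zero pq ¬rq P⇔R with P? (f zero) | R? (f zero)
... | no ¬p | _     = ⊥-elim (¬p pq)
... | yes _ | yes r = ⊥-elim (¬rq r)
... | yes _ | no _  = cong suc (length-filter-tabulate-cong P? R? (f ∘ suc) (λ i → P⇔R (suc i) λ ()))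
length-filter-tabulate-insert {l = suc l} P? R? f (suc q) pq ¬rq P⇔R
  with P? (f zero) | R? (f zero)
     | length-filter-tabulate-insert P? R? (f ∘ suc) q pq ¬rq (λ i i≢q → P⇔R (suc i) (i≢q ∘ Finₚ.suc-injective))
... | yes p | yes r | ih = cong suc ih
... | no ¬p | no ¬r | ih = ih
... | yes p | no ¬r | ih = ⊥-elim (¬r (proj₁ (P⇔R zero λ ()) p))
... | no ¬p | yes r | ih = ⊥-elim (¬p (proj₂ (P⇔R zero λ ()) r))

count : ℕ → List (Fin l) → ℕ
count j xs = length (filter (λ x → toℕ x ≟ j) xs)

count-++ : ∀ j (xs ys : List (Fin l)) → count j (xs ++ ys) ≡ count j xs + count j ys
count-++ j xs ys = trans (cong length (filter-++ _ xs ys)) (length-++ (filter _ xs))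

count-hit : ∀ (x : Fin l) xs → count (toℕ x) (x ∷ xs) ≡ suc (count (toℕ x) xs)
count-hit x xs = cong length (filter-accept (λ y → toℕ y ≟ toℕ x) refl)

count-miss : ∀ {j} {x : Fin l} xs → toℕ x ≢ j → count j (x ∷ xs) ≡ count j xs
count-miss {j = j} xs x≢j = cong length (filter-reject (λ y → toℕ y ≟ j) x≢j)

count-∷ʳ-hit : ∀ (xs : List (Fin l)) x → count (toℕ x) (xs ∷ʳ x) ≡ suc (count (toℕ x) xs)
count-∷ʳ-hit xs x = trans (count-++ (toℕ x) xs (x ∷ []))
  (trans (cong (count (toℕ x) xs +_) (count-hit x [])) (+-comm (count (toℕ x) xs) 1))

count-∷ʳ-miss : ∀ {j} (xs : List (Fin l)) {x} → toℕ x ≢ j → count j (xs ∷ʳ x) ≡ count j xs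
count-∷ʳ-miss {j = j} xs {x} x≢j = trans (count-++ j xs (x ∷ []))
  (trans (cong (count j xs +_) (count-miss [] x≢j)) (+-identityʳ _))

Σ< : ℕ → (ℕ → ℕ) → ℕ
Σ< zero    f = 0
Σ< (suc n) f = Σ< n f + f n

Σ<-cong : ∀ n {f g : ℕ → ℕ} → (∀ i → i < n → f i ≡ g i) → Σ< n f ≡ Σ< n g
Σ<-cong zero    f≗g = refl
Σ<-cong (suc n) f≗g = cong₂ _+_ (Σ<-cong n λ i i<n → f≗g i (m<n⇒m<1+n i<n)) (f≗g n ≤-refl)

Σ<-const : ∀ n k → Σ< n (λ _ → k) ≡ n * k
Σ<-const zero    k = refl
Σ<-const (suc n) k = trans (cong (_+ k) (Σ<-const n k)) (+-comm (n * k) k)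

Σ<-+ : ∀ n f g → Σ< n (λ i → f i + g i) ≡ Σ< n f + Σ< n g
Σ<-+ zero    f g = refl
Σ<-+ (suc n) f g = trans (cong (_+ (f n + g n)) (Σ<-+ n f g))
  (interchange (Σ< n f) (Σ< n g) (f n) (g n))

Σ<-head : ∀ n f → Σ< (suc n) f ≡ f 0 + Σ< n (f ∘ suc)
Σ<-head zero    f = sym (+-identityʳ (f 0))
Σ<-head (suc n) f = trans (cong (_+ f (suc n)) (Σ<-head n f)) (+-assoc (f 0) _ _)

Σ<-reverse : ∀ n f → Σ< (suc n) (λ i → f (n ∸ i)) ≡ Σ< (suc n) f
Σ<-reverse zero    f = refl
Σ<-reverse (suc n) f = trans (Σ<-head (suc n) _)
  (trans (cong (f (suc n) +_) (Σ<-reverse n f)) (+-comm (f (suc n)) _))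

Σ<-increment : ∀ n {f g : ℕ → ℕ} k → k < n → f k ≡ suc (g k) → (∀ j → k ≢ j → f j ≡ g j) →
  Σ< n f ≡ suc (Σ< n g)
Σ<-increment (suc n) {f} {g} k k<1+n fk f≗g with k ≟ n
... | yes refl = trans (cong₂ _+_ (Σ<-cong n λ i i<n → f≗g i (λ { refl → <-irrefl refl i<n })) fk)
                       (+-suc (Σ< n g) (g n))
... | no k≢n   = cong₂ _+_ (Σ<-increment n k (≤∧≢⇒< (≤-pred k<1+n) k≢n) fk f≗g) (f≗g n k≢n)

length≡Σcount : (xs : List (Fin l)) → length xs ≡ Σ< l (λ j → count j xs)
length≡Σcount {l} [] = sym (trans (Σ<-const l 0) (*-zeroʳ l))
length≡Σcount {l} (x ∷ xs) = sym (trans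
  (Σ<-increment l (toℕ x) (Finₚ.toℕ<n x) (count-hit x xs) (λ j → count-miss xs))
  (cong suc (sym (length≡Σcount xs))))

-- Selecting positions of c c c ⋯

module _ {n : ℕ} .{{_ : NonZero n}} (c : Vec (Fin n) n) (e : ℕ → ℕ) where

  -- At position `p` the quotient `p / n` is ℓ - 1, where ℓ numbers the copies of the letter found
  -- there.
  Selected : ℕ → Set
  Selected p = p / n < e (toℕ (cinf c p))

  selected? : Decidable Selected
  selected? p = p / n <? e (toℕ (cinf c p))

  selectedFrom : ℕ → ℕ → List ℕ
  selectedFrom p zero = []
  selectedFrom p (suc r) with selected? p
  ... | yes _ = p ∷ selectedFrom (suc p) r
  ... | no  _ = selectedFrom (suc p) r

  -- The same selection grown at its right end. This form suits inductions over prefixes,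
  -- `selectedFrom` suits the left-to-right comparison of positions.
  selectedBelow : ℕ → List ℕ
  selectedBelow zero = []
  selectedBelow (suc p) with selected? p
  ... | yes _ = selectedBelow p ∷ʳ p
  ... | no  _ = selectedBelow p

  selectedBelow-++ : ∀ p r → selectedBelow p ++ selectedFrom p r ≡ selectedBelow (p + r)
  selectedBelow-++ p zero = trans (++-identityʳ _) (cong selectedBelow (sym (+-identityʳ p)))
  selectedBelow-++ p (suc r) with selected? p | selectedBelow-++ (suc p) r
  ... | yes _ | ih = trans (sym (++-assoc (selectedBelow p) (p ∷ []) (selectedFrom (suc p) r)))
                           (trans ih (cong selectedBelow (sym (+-suc p r))))
  ... | no  _ | ih = trans ih (cong selectedBelow (sym (+-suc p r)))

  selectedFrom-increasing′ : ∀ x p r → x < p → Increasing (x ∷ selectedFrom p r)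
  selectedFrom-increasing′ x p zero x<p = [-]
  selectedFrom-increasing′ x p (suc r) x<p with selected? p
  ... | yes _ = x<p ∷ selectedFrom-increasing′ p (suc p) r ≤-refl
  ... | no  _ = selectedFrom-increasing′ x (suc p) r (m<n⇒m<1+n x<p)

  selectedFrom-increasing : ∀ p r → Increasing (selectedFrom p r)
  selectedFrom-increasing p zero = []
  selectedFrom-increasing p (suc r) with selected? p
  ... | yes _ = selectedFrom-increasing′ p (suc p) r ≤-refl
  ... | no  _ = selectedFrom-increasing (suc p) r

  count-exhausted : ∀ j q r → e j ≤ q / n → count j (subword c (selectedFrom q r)) ≡ 0
  count-exhausted j q zero    ej≤ = refl
  count-exhausted j q (suc r) ej≤ with selected? q
  ... | no _ = count-exhausted j (suc q) r (≤-trans ej≤ (/-monoˡ-≤ n (n≤1+n q)))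
  ... | yes sel = trans (count-miss {x = cinf c q} (subword c (selectedFrom (suc q) r)) (λ { refl → <⇒≱ sel ej≤ }))
                        (count-exhausted j (suc q) r (≤-trans ej≤ (/-monoˡ-≤ n (n≤1+n q))))

-- Length functions

-- What an inversion count must satisfy in order to agree with word length. `Good` will be
-- injectivity, because a vector of entries need not be a permutation.
record Length {n : ℕ} {G : Set} (ε : G) (_·_ : G → Fin n → G) : Set₁ where
  field
    ℓ            : G → ℕ
    Good         : G → Set
    Good-ε       : Good ε
    Good-·       : ∀ g t → Good g → Good (g · t)
    ·-involutive : ∀ g t → (g · t) · t ≡ g
    ℓ-ε          : ℓ ε ≡ 0
    ℓ-·          : ∀ g t → ℓ (g · t) ≤ suc (ℓ g)
    no-descent   : ∀ g → Good g → (∀ t → ℓ g ≤ ℓ (g · t)) → g ≡ ε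

  ev : List (Fin n) → G
  ev = foldl _·_ ε

  ℓ-foldl : ∀ g xs → ℓ (foldl _·_ g xs) ≤ ℓ g + length xs
  ℓ-foldl g []       = m≤m+n (ℓ g) 0
  ℓ-foldl g (x ∷ xs) = ≤-trans (ℓ-foldl (g · x) xs)
    (≤-trans (+-monoˡ-≤ (length xs) (ℓ-· g x)) (≤-reflexive (sym (+-suc (ℓ g) (length xs)))))

  ℓ-ev : ∀ xs → ℓ (ev xs) ≤ length xs
  ℓ-ev xs = ≤-trans (ℓ-foldl ε xs) (≤-reflexive (cong (_+ length xs) ℓ-ε))

  Good-foldl : ∀ g xs → Good g → Good (foldl _·_ g xs)
  Good-foldl g []       good = good
  Good-foldl g (x ∷ xs) good = Good-foldl (g · x) xs (Good-· g x good)

  -- Sorting along descents: generators that lower ℓ are applied until none is left, and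
  -- `no-descent` recognises the identity. The bound `k` makes the recursion structural.
  word : ∀ k g → Good g → ℓ g ≤ k → ∃ λ xs → ev xs ≡ g × length xs ≤ k
  word k g good ℓ≤k with Finₚ.any? (λ t → ℓ (g · t) <? ℓ g)
  word k g good ℓ≤k | no none = [] , sym (no-descent g good λ t → ≮⇒≥ λ lt → none (t , lt)) , z≤n
  word zero g good ℓ≤k | yes (t , lt) = ⊥-elim (<⇒≱ (≤-trans lt ℓ≤k) z≤n)
  word (suc k) g good ℓ≤k | yes (t , lt) =
    let xs , eq , len = word k (g · t) (Good-· g t good) (≤-pred (≤-trans lt ℓ≤k)) in
    xs ∷ʳ t ,
    trans (foldl-∷ʳ _·_ ε t xs) (trans (cong (_· t) eq) (·-involutive g t)) ,
    ≤-trans (≤-reflexive (trans (length-++ xs) (+-comm (length xs) 1))) (s≤s len)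

  -- Generators are involutions, so the letters cancel from the middle outwards. This removes w∘⁻¹
  -- w∘ when ψ is computed.
  foldl-reverse : ∀ g xs → foldl _·_ (foldl _·_ g (reverse xs)) xs ≡ g
  foldl-reverse g [] = refl
  foldl-reverse g (x ∷ xs) = trans
    (cong (λ h → foldl _·_ (h · x) xs)
      (trans (cong (foldl _·_ g) (unfold-reverse x xs)) (foldl-∷ʳ _·_ g x (reverse xs))))
    (trans (cong (λ h → foldl _·_ h xs) (·-involutive _ x)) (foldl-reverse g xs))

  module _ (_≟G_ : DecidableEquality G) where
    open Coxeter ev _≟G_

    reduced⇒length≤ℓ : ∀ xs → Reduced xs → length xs ≤ ℓ (ev xs)
    reduced⇒length≤ℓ xs red =
      let ys , eq , len = word (ℓ (ev xs)) (ev xs) (Good-foldl ε xs Good-ε) ≤-refl in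
      ≤-trans (red ys eq) len

    -- The selected word is the lexicographically first one because every
    -- skipped letter is a descent of the prefix read so far.
    module Greedy .{{_ : NonZero n}} (c : Vec (Fin n) n) (e : ℕ → ℕ) (M : ℕ)
      (ℓ-max : ∀ g → ℓ g ≤ length (selectedFrom c e 0 M))
      (ℓ-P : length (selectedFrom c e 0 M) ≤ ℓ (ev (subword c (selectedFrom c e 0 M))))
      (skip : ∀ pre p r → p < M → pre ++ selectedFrom c e p r ≡ selectedFrom c e 0 M → ¬ Selected c e p →
              ℓ (ev (subword c pre) · cinf c p) < ℓ (ev (subword c pre)))
      where

      private
        P = selectedFrom c e 0 M

      selected-candidate : WoCandidate c P
      selected-candidate = selectedFrom-increasing c e 0 M ,
        (λ vs eq → ≤-trans (≤-reflexive (length-map (cinf c) P)) (≤-trans ℓ-P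
           (≤-trans (≤-reflexive (cong ℓ (sym eq))) (ℓ-ev vs)))) ,
        (λ vs red → ≤-trans (reduced⇒length≤ℓ vs red) (≤-trans (ℓ-max (ev vs))
           (≤-reflexive (sym (length-map (cinf c) P)))))

      -- Unlike `Increasing`, this carries the current reading position, which can advance as soon
      -- as the next entry is known to differ from it.
      data Above : ℕ → List ℕ → Set where
        []  : ∀ {p} → Above p []
        _∷_ : ∀ {p x xs} → p ≤ x → Above (suc x) xs → Above p (x ∷ xs)

      increasing⇒above : ∀ {p x xs} → p ≤ x → Increasing (x ∷ xs) → Above p (x ∷ xs)
      increasing⇒above p≤x [-]         = p≤x ∷ []
      increasing⇒above p≤x (x<y ∷ inc) = p≤x ∷ increasing⇒above x<y inc

      above-suc : ∀ {p x xs} → x ≢ p → Above p (x ∷ xs) → Above (suc p) (x ∷ xs)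
      above-suc x≢p (p≤x ∷ ab) = ≤∧≢⇒< p≤x (x≢p ∘ sym) ∷ ab

      -- A letter that lowers ℓ costs two: ℓ drops where the word grows, and each later letter
      -- recovers at most its own unit.
      descent-not-reduced : ∀ pre p rest →
        ℓ (ev (subword c pre) · cinf c p) < ℓ (ev (subword c pre)) →
        ¬ (length (pre ++ p ∷ rest) ≤ ℓ (ev (subword c (pre ++ p ∷ rest))))
      descent-not-reduced pre p rest desc len = <⇒≱ (begin-strict
        ℓ (ev (subword c (pre ++ p ∷ rest)))
          ≡⟨ cong (ℓ ∘ ev) (map-++ (cinf c) pre (p ∷ rest)) ⟩
        ℓ (ev (subword c pre ++ cinf c p ∷ subword c rest))
          ≡⟨ cong ℓ (foldl-++ _·_ ε (subword c pre) (cinf c p ∷ subword c rest)) ⟩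
        ℓ (foldl _·_ (ev (subword c pre) · cinf c p) (subword c rest))
          ≤⟨ ℓ-foldl _ (subword c rest) ⟩
        ℓ (ev (subword c pre) · cinf c p) + length (subword c rest)
          <⟨ +-mono-<-≤ desc (≤-reflexive (length-map (cinf c) rest)) ⟩
        ℓ (ev (subword c pre)) + length rest
          ≤⟨ +-monoˡ-≤ (length rest) (ℓ-ev (subword c pre)) ⟩
        length (subword c pre) + length rest
          ≡⟨ cong (_+ length rest) (length-map (cinf c) pre) ⟩
        length pre + length rest
          ≤⟨ +-monoʳ-≤ (length pre) (n≤1+n (length rest)) ⟩
        length pre + length (p ∷ rest)
          ≡⟨ length-++ pre ⟨
        length (pre ++ p ∷ rest) ∎) len
        where open ≤-Reasoning

      -- Induction along the positions p. At a selected p the lexicographic bound and `Above` pin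
      -- the next entry of the given word to p. At a skipped p that entry cannot be p, since the
      -- letter there is a descent and the given word is reduced.
      lex-first-rest : ∀ r p pre rest → p + r ≡ M → pre ++ selectedFrom c e p r ≡ P →
        length (pre ++ rest) ≤ ℓ (ev (subword c (pre ++ rest))) →
        Above p rest → length rest ≡ length (selectedFrom c e p r) →
        rest ≤lex selectedFrom c e p r → rest ≡ selectedFrom c e p r
      lex-first-rest zero    p pre []       pr eq red ab len lex = refl
      lex-first-rest (suc r) p pre rest pr eq red ab len lex with selected? c e p in s
      lex-first-rest (suc r) p pre (x ∷ rest) pr eq red (p≤x ∷ ab) len (here x<p) | yes _ = ⊥-elim (<⇒≱ x<p p≤x)
      lex-first-rest (suc r) p pre (.p ∷ rest) pr eq red (p≤p ∷ ab) len (there lex) | yes _ =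
        cong (p ∷_) (lex-first-rest r (suc p) (pre ∷ʳ p) rest (trans (sym (+-suc p r)) pr)
          (trans (++-assoc pre _ _) eq)
          (subst (λ z → length z ≤ ℓ (ev (subword c z))) (sym (++-assoc pre (p ∷ []) rest)) red)
          ab (suc-injective len) lex)
      lex-first-rest (suc r) p pre [] pr eq red ab len lex | no _ =
        lex-first-rest r (suc p) pre [] (trans (sym (+-suc p r)) pr) eq red [] len lex
      lex-first-rest (suc r) p pre (x ∷ rest) pr eq red ab len lex | no ¬sel with x ≟ p
      ... | no x≢p  = lex-first-rest r (suc p) pre (x ∷ rest) (trans (sym (+-suc p r)) pr) eq red (above-suc x≢p ab) len lex
      ... | yes refl = ⊥-elim (descent-not-reduced pre p rest
              (skip pre p (suc r) (≤-trans (m<m+n p (s≤s z≤n)) (≤-reflexive pr)) (trans (cong (pre ++_) unfold) eq) ¬sel) red)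
        where
        unfold : selectedFrom c e p (suc r) ≡ selectedFrom c e (suc p) r
        unfold rewrite s = refl

      -- Minimality of `ps` enters through the comparison with the competitor `P`. Both have maximal
      -- length, so neither is a proper prefix of the other.
      lex-first : ∀ ps → IsWoC c ps → ps ≡ P
      lex-first ps ((inc , red , longest) , first) =
        lex-first-rest M 0 [] ps refl refl red′ (above inc) len (first P selected-candidate)
        where
        above : ∀ {xs} → Increasing xs → Above 0 xs
        above []          = []
        above [-]         = z≤n ∷ []
        above (x<y ∷ inc) = increasing⇒above z≤n (x<y ∷ inc)
        red′ : length ps ≤ ℓ (ev (subword c ps))
        red′ = ≤-trans (≤-reflexive (sym (length-map (cinf c) ps))) (reduced⇒length≤ℓ (subword c ps) red)
        len : length ps ≡ length P
        len = ≤-antisym (≤-trans red′ (ℓ-max _))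
          (≤-trans (≤-reflexive (sym (length-map (cinf c) P)))
            (≤-trans (longest (subword c P) (proj₁ (proj₂ selected-candidate)))
              (≤-reflexive (length-map (cinf c) ps))))

-- Adjacent transpositions of vectors

-- Recursive replacement for the tabulated `swapVec`, so that swaps and statistics unfold along the
-- vector together.
swapAdj : Vec X (suc l) → Fin l → Vec X (suc l)
swapAdj (x ∷ xs)     (suc t) = x ∷ swapAdj xs t
swapAdj (x ∷ y ∷ zs) zero    = y ∷ x ∷ zs

swapVec≡swapAdj : (v : Vec X (suc l)) (t : Fin l) → swapVec (inject₁ t) (suc t) v ≡ swapAdj v t
swapVec≡swapAdj (x ∷ y ∷ zs) zero    = cong (λ ws → y ∷ x ∷ ws) (tabulate∘lookup zs)
swapVec≡swapAdj (x ∷ y ∷ zs) (suc t) = cong (x ∷_) (swapVec≡swapAdj (y ∷ zs) t)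

swapAdj-involutive : (v : Vec X (suc l)) (t : Fin l) → swapAdj (swapAdj v t) t ≡ v
swapAdj-involutive (x ∷ y ∷ zs) zero    = refl
swapAdj-involutive (x ∷ y ∷ zs) (suc t) = cong (x ∷_) (swapAdj-involutive (y ∷ zs) t)

map-swapAdj : (f : X → Y) (v : Vec X (suc l)) (t : Fin l) → Vec.map f (swapAdj v t) ≡ swapAdj (Vec.map f v) t
map-swapAdj f (x ∷ y ∷ zs) zero    = refl
map-swapAdj f (x ∷ y ∷ zs) (suc t) = cong (f x ∷_) (map-swapAdj f (y ∷ zs) t)

σ : Fin l → Fin (suc l) → Fin (suc l)
σ zero    zero          = suc zero
σ zero    (suc zero)    = zero
σ zero    (suc (suc i)) = suc (suc i)
σ (suc t) zero          = zero
σ (suc t) (suc i)       = suc (σ t i)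

σ-involutive : (t : Fin l) (i : Fin (suc l)) → σ t (σ t i) ≡ i
σ-involutive zero    zero          = refl
σ-involutive zero    (suc zero)    = refl
σ-involutive zero    (suc (suc i)) = refl
σ-involutive (suc t) zero          = refl
σ-involutive (suc t) (suc i)       = cong suc (σ-involutive t i)

lookup-swapAdj : (v : Vec X (suc l)) (t : Fin l) (i : Fin (suc l)) → lookup (swapAdj v t) i ≡ lookup v (σ t i)
lookup-swapAdj (x ∷ y ∷ zs) zero    zero          = refl
lookup-swapAdj (x ∷ y ∷ zs) zero    (suc zero)    = refl
lookup-swapAdj (x ∷ y ∷ zs) zero    (suc (suc i)) = refl
lookup-swapAdj (x ∷ y ∷ zs) (suc t) zero          = refl
lookup-swapAdj (x ∷ y ∷ zs) (suc t) (suc i)       = lookup-swapAdj (y ∷ zs) t i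

data σ-View (t : Fin l) : Fin (suc l) → Fin (suc l) → Set where
  left  : σ-View t (inject₁ t) (suc t)
  right : σ-View t (suc t) (inject₁ t)
  fixed : ∀ {i} → toℕ i ≢ toℕ t → toℕ i ≢ suc (toℕ t) → σ-View t i i

σ-view : (t : Fin l) (i : Fin (suc l)) → σ-View t i (σ t i)
σ-view zero    zero          = left
σ-view zero    (suc zero)    = right
σ-view zero    (suc (suc i)) = fixed (λ ()) (λ ())
σ-view (suc t) zero          = fixed (λ ()) (λ ())
σ-view (suc t) (suc i) with σ t i | σ-view t i
... | _ | left        = left
... | _ | right       = right
... | _ | fixed ≢t ≢s = fixed (≢t ∘ suc-injective) (≢s ∘ suc-injective)

lookup-ext : {v w : Vec X l} → (∀ i → lookup v i ≡ lookup w i) → v ≡ w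
lookup-ext {v = v} {w} eq = trans (sym (tabulate∘lookup v)) (trans (tabulate-cong eq) (tabulate∘lookup w))

-- Inversion statistics

⟦_⟧ : {P : Set} → Dec P → ℕ
⟦ d ⟧ = if does d then 1 else 0

⟦⟧≤1 : {P : Set} (d : Dec P) → ⟦ d ⟧ ≤ 1
⟦⟧≤1 (yes _) = ≤-refl
⟦⟧≤1 (no _)  = z≤n

⟦⟧-yes : {P : Set} (d : Dec P) → P → ⟦ d ⟧ ≡ 1
⟦⟧-yes (yes _) p = refl
⟦⟧-yes (no ¬p) p = ⊥-elim (¬p p)

⟦⟧-no : {P : Set} (d : Dec P) → ¬ P → ⟦ d ⟧ ≡ 0
⟦⟧-no (yes p) ¬p = ⊥-elim (¬p p)
⟦⟧-no (no _)  ¬p = refl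

⟦⟧-mono : {P Q : Set} (d : Dec P) (d′ : Dec Q) → (P → Q) → ⟦ d ⟧ ≤ ⟦ d′ ⟧
⟦⟧-mono (yes p) d′ f = ≤-reflexive (sym (⟦⟧-yes d′ (f p)))
⟦⟧-mono (no _)  d′ f = z≤n

⟦⟧-cong : {P Q : Set} (d : Dec P) (d′ : Dec Q) → (P → Q) → (Q → P) → ⟦ d ⟧ ≡ ⟦ d′ ⟧
⟦⟧-cong d d′ f g = ≤-antisym (⟦⟧-mono d d′ f) (⟦⟧-mono d′ d g)

-- Equal to n S + n (n - 1) R / 2, the value of `stat` when every entry contributes S and every pair
-- R.
total : ℕ → ℕ → ℕ → ℕ
total S R zero    = 0
total S R (suc n) = S + n * R + total S R n

total-0 : ∀ n → total 0 0 n ≡ 0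
total-0 zero    = refl
total-0 (suc n) = trans (cong (_+ total 0 0 n) (*-zeroʳ n)) (total-0 n)

module Statistic (s : X → ℕ) (r : X → X → ℕ) where

  row : X → Vec X l → ℕ
  row x []       = 0
  row x (y ∷ ys) = r x y + row x ys

  stat : Vec X l → ℕ
  stat []       = 0
  stat (x ∷ xs) = s x + row x xs + stat xs

  row-swap : ∀ x (v : Vec X (suc l)) t → row x (swapAdj v t) ≡ row x v
  row-swap x (y ∷ z ∷ zs) zero = solve 3 (λ a b d → a :+ (b :+ d) := b :+ (a :+ d)) refl (r x z) (r x y) (row x zs)
    where open +-*-Solver
  row-swap x (y ∷ z ∷ zs) (suc t) = cong (r x y +_) (row-swap x (z ∷ zs) t)

  -- Only the pair of swapped entries changes its order. Both contributions are added rather than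
  -- subtracted, to stay clear of truncated subtraction.
  stat-swap : ∀ (v : Vec X (suc l)) t →
    stat (swapAdj v t) + r (lookup v (inject₁ t)) (lookup v (suc t)) ≡
    stat v + r (lookup v (suc t)) (lookup v (inject₁ t))
  stat-swap (x ∷ y ∷ zs) zero = solve 7
    (λ sx sy rxy ryx px py p →
      sy :+ (ryx :+ py) :+ (sx :+ px :+ p) :+ rxy := sx :+ (rxy :+ px) :+ (sy :+ py :+ p) :+ ryx)
    refl (s x) (s y) (r x y) (r y x) (row x zs) (row y zs) (stat zs)
    where open +-*-Solver
  stat-swap (x ∷ y ∷ zs) (suc t)
    rewrite row-swap x (y ∷ zs) t
          | +-assoc (s x + row x (y ∷ zs)) (stat (swapAdj (y ∷ zs) t)) (r (lookup (y ∷ zs) (inject₁ t)) (lookup zs t))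
          | +-assoc (s x + row x (y ∷ zs)) (stat (y ∷ zs)) (r (lookup zs t) (lookup (y ∷ zs) (inject₁ t)))
          = cong (_+_ (s x + row x (y ∷ zs))) (stat-swap (y ∷ zs) t)

  stat≤total : ∀ {S R} (v : Vec X l) → (∀ i → s (lookup v i) ≤ S) →
    (∀ i j → toℕ i < toℕ j → r (lookup v i) (lookup v j) ≤ R) → stat v ≤ total S R l
  stat≤total [] s≤ r≤ = z≤n
  stat≤total {R = R} (x ∷ xs) s≤ r≤ =
    +-mono-≤ (+-mono-≤ (s≤ zero) (row≤ xs (λ j → r≤ zero (suc j) (s≤s z≤n))))
             (stat≤total xs (s≤ ∘ suc) (λ i j i<j → r≤ (suc i) (suc j) (s≤s i<j)))
    where
    row≤ : ∀ {l} (ys : Vec X l) → (∀ j → r x (lookup ys j) ≤ R) → row x ys ≤ l * R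
    row≤ []       h = z≤n
    row≤ (y ∷ ys) h = +-mono-≤ (h zero) (row≤ ys (h ∘ suc))

  total≤stat : ∀ {S R} (v : Vec X l) → (∀ i → S ≤ s (lookup v i)) →
    (∀ i j → toℕ i < toℕ j → R ≤ r (lookup v i) (lookup v j)) → total S R l ≤ stat v
  total≤stat [] s≥ r≥ = z≤n
  total≤stat {R = R} (x ∷ xs) s≥ r≥ =
    +-mono-≤ (+-mono-≤ (s≥ zero) (row≥ xs (λ j → r≥ zero (suc j) (s≤s z≤n))))
             (total≤stat xs (s≥ ∘ suc) (λ i j i<j → r≥ (suc i) (suc j) (s≤s i<j)))
    where
    row≥ : ∀ {l} (ys : Vec X l) → (∀ j → R ≤ r x (lookup ys j)) → l * R ≤ row x ys
    row≥ []       h = z≤n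
    row≥ (y ∷ ys) h = +-mono-≤ (h zero) (row≥ ys (h ∘ suc))

+-≡-≤ : ∀ {a b c d} → a + c ≡ b + d → b ≤ a → c ≤ d
+-≡-≤ {a} {b} {c} {d} eq b≤a = +-cancelˡ-≤ b c d (≤-trans (+-monoˡ-≤ c b≤a) (≤-reflexive eq))

strict-mono-lower : (f : Fin (suc l) → ℕ) → (∀ t → f (inject₁ t) < f (suc t)) → ∀ i → f zero + toℕ i ≤ f i
strict-mono-lower f inc zero = ≤-reflexive (+-identityʳ (f zero))
strict-mono-lower {suc l} f inc (suc i) = begin
  f zero + suc (toℕ i)   ≡⟨ +-suc (f zero) (toℕ i) ⟩
  suc (f zero) + toℕ i   ≤⟨ +-monoˡ-≤ (toℕ i) (inc zero) ⟩
  f (suc zero) + toℕ i   ≤⟨ strict-mono-lower (f ∘ suc) (inc ∘ suc) i ⟩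
  f (suc i)              ∎
  where open ≤-Reasoning

strict-mono-upper : (f : Fin (suc l) → ℕ) → (∀ t → f (inject₁ t) < f (suc t)) → ∀ i → f i + (l ∸ toℕ i) ≤ f (fromℕ l)
strict-mono-upper {l} f inc zero =
  subst (λ k → f zero + k ≤ f (fromℕ l)) (Finₚ.toℕ-fromℕ l) (strict-mono-lower f inc (fromℕ l))
strict-mono-upper {suc l} f inc (suc i) = strict-mono-upper (f ∘ suc) (inc ∘ suc) i

-- Counting steps from the left end gives i ≤ f i, counting them to the right end gives f i ≤ i.
strict-mono⇒id : (f : Fin (suc l) → Fin (suc l)) → (∀ t → toℕ (f (inject₁ t)) < toℕ (f (suc t))) → ∀ i → f i ≡ i
strict-mono⇒id {l} f inc i = Finₚ.toℕ-injective (≤-antisym upper lower)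
  where
  open ≤-Reasoning
  lower : toℕ i ≤ toℕ (f i)
  lower = ≤-trans (m≤n+m (toℕ i) (toℕ (f zero))) (strict-mono-lower (toℕ ∘ f) inc i)
  i≤n : toℕ i ≤ l
  i≤n = ≤-pred (Finₚ.toℕ<n i)
  upper : toℕ (f i) ≤ toℕ i
  upper = +-cancelʳ-≤ (l ∸ toℕ i) (toℕ (f i)) (toℕ i) (begin
    toℕ (f i) + (l ∸ toℕ i) ≤⟨ strict-mono-upper (toℕ ∘ f) inc i ⟩
    toℕ (f (fromℕ l))       ≤⟨ ≤-pred (Finₚ.toℕ<n (f (fromℕ l))) ⟩
    l                       ≡⟨ m+[n∸m]≡n i≤n ⟨
    toℕ i + (l ∸ toℕ i)     ∎)

-- Type A length

inversionA : Fin l → Fin l → ℕ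
inversionA x y = ⟦ toℕ y <? toℕ x ⟧

module StatA {n : ℕ} = Statistic {Fin n} (λ _ → 0) inversionA

+-≡-≤1 : ∀ {a b c d} → a + c ≡ b + d → d ≤ 1 → a ≤ suc b
+-≡-≤1 {a} {b} {c} {d} eq d≤1 = ≤-trans (m≤m+n a c) (≤-trans (≤-reflexive eq)
  (≤-trans (+-monoʳ-≤ b d≤1) (≤-reflexive (+-comm b 1))))

statA-act : ∀ {n} (v : GA n) t →
  StatA.stat (actA v t) + inversionA (lookup v (inject₁ t)) (lookup v (suc t)) ≡
  StatA.stat v + inversionA (lookup v (suc t)) (lookup v (inject₁ t))
statA-act v t = trans
  (cong (λ w → StatA.stat w + inversionA (lookup v (inject₁ t)) (lookup v (suc t))) (swapVec≡swapAdj v t))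
  (StatA.stat-swap v t)

lengthA : ∀ n → Length (Vec.allFin (suc n)) (actA {n})
lengthA n = record
  { ℓ            = stat
  ; Good         = λ v → ∀ i j → lookup v i ≡ lookup v j → i ≡ j
  ; Good-ε       = λ i j eq → trans (sym (lookup∘tabulate (λ k → k) i)) (trans eq (lookup∘tabulate (λ k → k) j))
  ; Good-·       = good
  ; ·-involutive = λ v t → trans (swapVec≡swapAdj _ t)
                     (trans (cong (λ w → swapAdj w t) (swapVec≡swapAdj v t)) (swapAdj-involutive v t))
  ; ℓ-ε          = n≤0⇒n≡0 (≤-trans (stat≤total {S = 0} {0} (Vec.allFin (suc n)) (λ _ → z≤n) noninversion)
                     (≤-reflexive (total-0 (suc n))))
  ; ℓ-·          = λ v t → +-≡-≤1 (statA-act v t) (⟦⟧≤1 (toℕ (lookup v (inject₁ t)) <? toℕ (lookup v (suc t))))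
  ; no-descent   = λ v inj asc → lookup-ext (λ i → trans (strict-mono⇒id (lookup v) (strict v inj asc) i)
                     (sym (lookup∘tabulate (λ k → k) i)))
  }
  where
  open StatA
  noninversion : ∀ i j → toℕ i < toℕ j →
    inversionA (lookup (Vec.allFin (suc n)) i) (lookup (Vec.allFin (suc n)) j) ≤ 0
  noninversion i j i<j rewrite lookup∘tabulate (λ (k : Fin (suc n)) → k) i | lookup∘tabulate (λ (k : Fin (suc n)) → k) j =
    ≤-reflexive (⟦⟧-no (toℕ j <? toℕ i) (<-asym i<j))
  good : ∀ (v : GA n) t → (∀ i j → lookup v i ≡ lookup v j → i ≡ j) →
         ∀ i j → lookup (actA v t) i ≡ lookup (actA v t) j → i ≡ j
  good v t inj i j eq rewrite swapVec≡swapAdj v t | lookup-swapAdj v t i | lookup-swapAdj v t j =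
    trans (sym (σ-involutive t i)) (trans (cong (σ t) (inj (σ t i) (σ t j) eq)) (σ-involutive t j))
  strict : ∀ (v : GA n) → (∀ i j → lookup v i ≡ lookup v j → i ≡ j) → (∀ t → stat v ≤ stat (actA v t)) →
           ∀ t → toℕ (lookup v (inject₁ t)) < toℕ (lookup v (suc t))
  strict v inj asc t with <-cmp (toℕ (lookup v (inject₁ t))) (toℕ (lookup v (suc t)))
  ... | tri< lt _ _ = lt
  ... | tri≈ _ eq _ = ⊥-elim (Finₚ.<⇒≢ (Finₚ.≤̄⇒inject₁< {i = t} {j = t} ≤-refl) (inj _ _ (Finₚ.toℕ-injective eq)))
  -- An inversion at `t` would make the statistic drop: cancelling in `statA-act` leaves 1 ≤ 0.
  ... | tri> ¬lt _ gt = ⊥-elim (<⇒≱ (s≤s z≤n) (subst₂ _≤_ (⟦⟧-yes (toℕ (lookup v (suc t)) <? toℕ (lookup v (inject₁ t))) gt)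
                          (⟦⟧-no (toℕ (lookup v (inject₁ t)) <? toℕ (lookup v (suc t))) ¬lt)
                          (+-≡-≤ (statA-act v t) (asc t))))

-- Type B length

signed : Bool × Fin l → ℤ
signed (false , j) = ℤ.+ suc (toℕ j)
signed (true  , j) = -[1+ toℕ j ]

neg : Bool × Fin l → Bool × Fin l
neg = map₁ not

signed-neg : (x : Bool × Fin l) → signed (neg x) ≡ ℤ.- signed x
signed-neg (false , j) = refl
signed-neg (true  , j) = refl

neg-involutive : (x : Bool × Fin l) → neg (neg x) ≡ x
neg-involutive (b , j) = cong (_, j) (Boolₚ.not-involutive b)

negative : Bool × Fin l → ℕ
negative (b , _) = if b then 1 else 0

negative≤1 : (x : Bool × Fin l) → negative x ≤ 1
negative≤1 (false , _) = z≤n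
negative≤1 (true  , _) = ≤-refl

below : Bool × Fin l → Bool × Fin l → ℕ
below x y = ⟦ signed y ℤ.<? signed x ⟧

below≤1 : (x y : Bool × Fin l) → below x y ≤ 1
below≤1 x y = ⟦⟧≤1 (signed y ℤ.<? signed x)

-- For i < j this counts w(i) > w(j) and w(i) + w(j) < 0. Adding the number of negative entries
-- gives the usual length function of type B.
inversionB : Bool × Fin l → Bool × Fin l → ℕ
inversionB x y = below x y + below (neg x) y

-- Both sides test whether the two values have a negative sum.
below-neg-sym : (x y : Bool × Fin l) → below (neg x) y ≡ below (neg y) x
below-neg-sym x y = ⟦⟧-cong (_ ℤ.<? _) (_ ℤ.<? _) (flip x y) (flip y x)
  where
  flip : ∀ x y → signed y ℤ.< signed (neg x) → signed x ℤ.< signed (neg y)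
  flip x y lt = subst₂ ℤ._<_ (trans (cong ℤ.-_ (signed-neg x)) (ℤₚ.neg-involutive (signed x)))
                  (sym (signed-neg y)) (ℤₚ.neg-mono-< lt)

module StatB {n : ℕ} = Statistic {Bool × Fin n} negative inversionB

-- Negating the head exchanges the two summands of `inversionB` along its row, so only its own sign
-- counts. This relies on the head being the left argument in every pair.
stat-neg-head : ∀ (x : Bool × Fin l) {m} (xs : Vec (Bool × Fin l) m) →
  StatB.stat (neg x ∷ xs) + negative x ≡ StatB.stat (x ∷ xs) + negative (neg x)
stat-neg-head x xs = trans
  (cong (λ k → negative (neg x) + k + stat xs + negative x) (row-neg xs))
  (solve 4 (λ a b p q → a :+ p :+ q :+ b := b :+ p :+ q :+ a) refl (negative (neg x)) (negative x) (row x xs) (stat xs))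
  where
  open StatB
  open +-*-Solver
  row-neg : ∀ {m} (ys : Vec _ m) → row (neg x) ys ≡ row x ys
  row-neg [] = refl
  row-neg (y ∷ ys) = cong₂ _+_
    (trans (cong (λ z → below (neg x) y + below z y) (neg-involutive x)) (+-comm (below (neg x) y) (below x y)))
    (row-neg ys)

lengthB : ∀ n → Length (Vec.tabulate (λ j → (false , j))) (actB {suc n})
lengthB n = record
  { ℓ            = stat
  ; Good         = Good
  ; Good-ε       = λ i j eq → trans (sym (cong proj₂ (lookup∘tabulate (false ,_) i)))
                     (trans eq (cong proj₂ (lookup∘tabulate (false ,_) j)))
  ; Good-·       = good
  ; ·-involutive = involutive
  ; ℓ-ε          = n≤0⇒n≡0 (≤-trans (stat≤total {S = 0} {0} ε (λ i → ≤-reflexive (cong negative (lookup∘tabulate (false ,_) i))) noninversion)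
                     (≤-reflexive (total-0 (suc n))))
  ; ℓ-·          = step
  ; no-descent   = λ v inj asc → lookup-ext (λ i → trans
                     (cong₂ _,_ (positive v asc i) (strict-mono⇒id (proj₂ ∘ lookup v) (strict v inj asc) i))
                     (sym (lookup∘tabulate (false ,_) i)))
  }
  where
  open StatB
  ε : GB (suc n)
  ε = Vec.tabulate (λ j → (false , j))
  Good : GB (suc n) → Set
  Good v = ∀ i j → proj₂ (lookup v i) ≡ proj₂ (lookup v j) → i ≡ j
  noninversion : ∀ i j → toℕ i < toℕ j → inversionB (lookup ε i) (lookup ε j) ≤ 0
  noninversion i j i<j rewrite lookup∘tabulate {A = Bool × Fin (suc n)} (false ,_) i | lookup∘tabulate {A = Bool × Fin (suc n)} (false ,_) j =
    ≤-reflexive (cong₂ _+_ (⟦⟧-no (signed (false , j) ℤ.<? signed (false , i)) λ { (ℤ.+<+ (s≤s lt)) → <-asym i<j lt }) (⟦⟧-no (signed (false , j) ℤ.<? signed (true , i)) λ ()))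
  swap : ∀ (v : GB (suc n)) t → stat (actB v (suc t)) + inversionB (lookup v (inject₁ t)) (lookup v (suc t)) ≡
                                stat v + inversionB (lookup v (suc t)) (lookup v (inject₁ t))
  swap v t = trans (cong (λ w → stat w + inversionB (lookup v (inject₁ t)) (lookup v (suc t))) (swapVec≡swapAdj v t)) (stat-swap v t)
  -- The condition on the sum is symmetric and cancels; the comparison of the two values remains.
  swap-below : ∀ (v : GB (suc n)) t → stat (actB v (suc t)) + below (lookup v (inject₁ t)) (lookup v (suc t)) ≡
                                      stat v + below (lookup v (suc t)) (lookup v (inject₁ t))
  swap-below v t = +-cancelʳ-≡ (below (neg x) y) _ _ (trans (+-assoc (stat (actB v (suc t))) _ _) (trans (swap v t)
      (trans (cong (λ k → stat v + (below y x + k)) (sym (below-neg-sym x y))) (sym (+-assoc (stat v) _ _)))))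
    where
    x = lookup v (inject₁ t)
    y = lookup v (suc t)
  step : ∀ (v : GB (suc n)) t → stat (actB v t) ≤ suc (stat v)
  step (x ∷ xs) zero = +-≡-≤1 (stat-neg-head x xs) (negative≤1 (neg x))
  step v (suc t) = +-≡-≤1 (swap-below v t) (below≤1 (lookup v (suc t)) (lookup v (inject₁ t)))
  involutive : ∀ (v : GB (suc n)) t → actB (actB v t) t ≡ v
  involutive (x ∷ xs) zero = cong (_∷ xs) (neg-involutive x)
  involutive v (suc t) = trans (swapVec≡swapAdj _ t)
    (trans (cong (λ w → swapAdj w t) (swapVec≡swapAdj v t)) (swapAdj-involutive v t))
  good : ∀ v t → Good v → Good (actB v t)
  good (x ∷ xs) zero inj i j eq = inj i j (trans (sym (same i)) (trans eq (same j)))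
    where
    same : ∀ i → proj₂ (lookup (neg x ∷ xs) i) ≡ proj₂ (lookup (x ∷ xs) i)
    same zero    = refl
    same (suc i) = refl
  good v (suc t) inj i j eq rewrite swapVec≡swapAdj v t | lookup-swapAdj v t i | lookup-swapAdj v t j =
    trans (sym (σ-involutive t i)) (trans (cong (σ t) (inj (σ t i) (σ t j) eq)) (σ-involutive t j))
  not-below : ∀ (v : GB (suc n)) → (∀ t → stat v ≤ stat (actB v t)) →
              ∀ t → signed (lookup v (inject₁ t)) ℤ.≤ signed (lookup v (suc t))
  not-below v asc t = ℤₚ.≮⇒≥ λ lt → <⇒≱ (s≤s z≤n) (subst₂ _≤_
    (⟦⟧-yes (signed (lookup v (suc t)) ℤ.<? signed (lookup v (inject₁ t))) lt)
    (⟦⟧-no (signed (lookup v (inject₁ t)) ℤ.<? signed (lookup v (suc t))) (ℤₚ.<-asym lt)) (+-≡-≤ (swap-below v t) (asc (suc t))))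
  -- The first entry is positive because the sign change is no descent, and weakly increasing values
  -- pass this on to the right.
  positive : ∀ (v : GB (suc n)) → (∀ t → stat v ≤ stat (actB v t)) → ∀ i → proj₁ (lookup v i) ≡ false
  positive v@(x ∷ xs) asc = <-weakInduction _ (base x (+-≡-≤ (stat-neg-head x xs) (asc zero))) λ i →
      next (lookup v (inject₁ i)) (lookup v (suc i)) (not-below v asc i)
    where
    base : (x : Bool × Fin (suc n)) → negative x ≤ negative (neg x) → proj₁ x ≡ false
    base (false , _) _ = refl
    base (true , _) ()
    next : (x y : Bool × Fin (suc n)) → signed x ℤ.≤ signed y → proj₁ x ≡ false → proj₁ y ≡ false
    next (false , _) (false , _) _ _ = refl
  strict : ∀ v → Good v → (∀ t → stat v ≤ stat (actB v t)) →
           ∀ t → toℕ (proj₂ (lookup v (inject₁ t))) < toℕ (proj₂ (lookup v (suc t)))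
  strict v inj asc t = ≤∧≢⇒< (weak (lookup v (inject₁ t)) (lookup v (suc t)) (positive v asc (inject₁ t)) (positive v asc (suc t)) (not-below v asc t))
    λ eq → Finₚ.<⇒≢ (Finₚ.≤̄⇒inject₁< {i = t} {j = t} ≤-refl) (inj _ _ (Finₚ.toℕ-injective eq))
    where
    weak : (x y : Bool × Fin (suc n)) → proj₁ x ≡ false → proj₁ y ≡ false →
           signed x ℤ.≤ signed y → toℕ (proj₂ x) ≤ toℕ (proj₂ y)
    weak (false , _) (false , _) _ _ (ℤ.+≤+ (s≤s le)) = le

-- Labels of the wires

-- Adjacent columns fire alternately, so the one that comes first in c is level with the other or
-- one ahead.
Lead : ℕ → ℕ → Set
Lead x y = x ≡ y ⊎ x ≡ suc y

¬Lead-suc : ∀ {x} → ¬ Lead x (suc x)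
¬Lead-suc (inj₁ ())
¬Lead-suc (inj₂ ())

¬Lead-2+ : ∀ {x} → ¬ Lead (suc (suc x)) x
¬Lead-2+ (inj₁ ())
¬Lead-2+ (inj₂ ())

module Labels (m : ℕ) (up : ℕ → Bool) where

  private
    n = suc m

  asc desc : ℕ → ℕ
  asc  zero    = 0
  asc  (suc g) = if up g then suc (asc g) else asc g
  desc zero    = 0
  desc (suc g) = if up g then desc g else suc (desc g)

  asc+desc : ∀ g → asc g + desc g ≡ g
  asc+desc zero = refl
  asc+desc (suc g) with up g
  ... | true  = cong suc (asc+desc g)
  ... | false = trans (+-suc (asc g) (desc g)) (cong suc (asc+desc g))

  asc-mono : ∀ {g} j → g ≤ j → asc g ≤ asc j
  asc-mono zero z≤n = ≤-refl
  asc-mono {g} (suc j) g≤1+j with m≤n⇒m<n∨m≡n g≤1+j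
  ... | inj₂ refl = ≤-refl
  ... | inj₁ (s≤s g≤j) with up j
  ...   | true  = m≤n⇒m≤1+n (asc-mono j g≤j)
  ...   | false = asc-mono j g≤j

  desc-mono : ∀ {g} j → g ≤ j → desc g ≤ desc j
  desc-mono zero z≤n = ≤-refl
  desc-mono {g} (suc j) g≤1+j with m≤n⇒m<n∨m≡n g≤1+j
  ... | inj₂ refl = ≤-refl
  ... | inj₁ (s≤s g≤j) with up j
  ...   | true  = desc-mono j g≤j
  ...   | false = m≤n⇒m≤1+n (desc-mono j g≤j)

  asc-up : ∀ {g} → up g ≡ true → asc (suc g) ≡ suc (asc g)
  asc-up eq rewrite eq = refl

  asc-down : ∀ {g} → up g ≡ false → asc (suc g) ≡ asc g
  asc-down eq rewrite eq = refl

  desc-up : ∀ {g} → up g ≡ true → desc (suc g) ≡ desc g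
  desc-up eq rewrite eq = refl

  desc-down : ∀ {g} → up g ≡ false → desc (suc g) ≡ suc (desc g)
  desc-down eq rewrite eq = refl

  -- n − desc g, written without subtracting desc
  bwd : ℕ → ℕ
  bwd g = asc g + (n ∸ g)

  bwd+desc : ∀ {g} → g ≤ n → bwd g + desc g ≡ n
  bwd+desc {g} g≤n = begin
    asc g + (n ∸ g) + desc g   ≡⟨ solve 3 (λ a k d → a :+ k :+ d := a :+ d :+ k) refl (asc g) (n ∸ g) (desc g) ⟩
    asc g + desc g + (n ∸ g)   ≡⟨ cong (_+ (n ∸ g)) (asc+desc g) ⟩
    g + (n ∸ g)                ≡⟨ m+[n∸m]≡n g≤n ⟩
    n                          ∎
    where open ≡-Reasoning
          open +-*-Solver

  bwd-up : ∀ {g} → g < n → up g ≡ true → bwd (suc g) ≡ bwd g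
  bwd-up {g} g<n eq = +-cancelʳ-≡ (desc g) _ _
    (trans (cong (bwd (suc g) +_) (sym (desc-up eq))) (trans (bwd+desc g<n) (sym (bwd+desc (<⇒≤ g<n)))))

  bwd-down : ∀ {g} → g < n → up g ≡ false → suc (bwd (suc g)) ≡ bwd g
  bwd-down {g} g<n eq = +-cancelʳ-≡ (desc g) _ _
    (trans (sym (+-suc (bwd (suc g)) (desc g)))
      (trans (cong (bwd (suc g) +_) (sym (desc-down eq))) (trans (bwd+desc g<n) (sym (bwd+desc (<⇒≤ g<n))))))

  Interlaced : (ℕ → ℕ) → Set
  Interlaced t = ∀ g → suc g < n →
    (up g ≡ true → Lead (t g) (t (suc g))) × (up g ≡ false → Lead (t (suc g)) (t g))

  -- Lab t g x: after column i has fired t i times, the wire between the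
  -- columns g and g + 1 has label x.
  data Lab (t : ℕ → ℕ) (g : ℕ) : ℕ → Set where
    wall       : suc g ≡ n → Lab t g (asc g + t g)
    up-left    : suc g < n → up g ≡ true  → t g ≡ t (suc g) → Lab t g (asc g + t g)
    down-left  : suc g < n → up g ≡ false → t (suc g) ≡ suc (t g) → Lab t g (asc g + t g)
    up-right   : suc g < n → up g ≡ true  → t g ≡ suc (t (suc g)) → Lab t g (bwd (suc g) + t (suc g))
    down-right : suc g < n → up g ≡ false → t (suc g) ≡ t g → Lab t g (bwd (suc g) + t (suc g))

  Lab-cong : ∀ {t t′ g x} → t g ≡ t′ g → (suc g < n → t (suc g) ≡ t′ (suc g)) → Lab t g x → Lab t′ g x
  Lab-cong {g = g} e₁ e₂ (wall eq) = subst (λ z → Lab _ g (asc g + z)) (sym e₁) (wall eq)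
  Lab-cong {g = g} e₁ e₂ (up-left lt u eq) =
    subst (λ z → Lab _ g (asc g + z)) (sym e₁) (up-left lt u (trans (sym e₁) (trans eq (e₂ lt))))
  Lab-cong {g = g} e₁ e₂ (down-left lt u eq) =
    subst (λ z → Lab _ g (asc g + z)) (sym e₁) (down-left lt u (trans (sym (e₂ lt)) (trans eq (cong suc e₁))))
  Lab-cong {g = g} e₁ e₂ (up-right lt u eq) =
    subst (λ z → Lab _ g (bwd (suc g) + z)) (sym (e₂ lt)) (up-right lt u (trans (sym e₁) (trans eq (cong suc (e₂ lt)))))
  Lab-cong {g = g} e₁ e₂ (down-right lt u eq) =
    subst (λ z → Lab _ g (bwd (suc g) + z)) (sym (e₂ lt)) (down-right lt u (trans (sym (e₂ lt)) (trans eq e₁)))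

  record Fire (t t′ : ℕ → ℕ) (i : ℕ) : Set where
    field
      i<n    : i < n
      fired  : t′ i ≡ suc (t i)
      others : ∀ j → i ≢ j → t′ j ≡ t j
      after  : Interlaced t′

  module _ {t t′ i} (fire : Fire t t′ i) where
    open Fire fire

    -- To the right of column i the crossing replaces the wire asc i + t i by bwd i + t i. Each
    -- `Lab` constructor names a wire through the adjacent column that fires next; `bwd-up` and
    -- `bwd-down` translate the name from column i to column i + 1.
    fire-right : ∀ {x} → Lab t i x → x ≡ asc i + t i × Lab t′ i (bwd i + t i)
    fire-right (wall eq) = refl , subst (Lab t′ i) label (wall eq)
      where
      -- At the wall i = m and bwd m = asc m + 1, so the outgoing wire is the one that enters the
      -- same column at its next firing.
      label : asc i + t′ i ≡ bwd i + t i
      label rewrite fired | suc-injective eq | +-∸-assoc 1 (≤-refl {m}) | n∸n≡0 m =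
        trans (+-suc (asc m) (t m)) (cong (_+ t m) (+-comm 1 (asc m)))
    fire-right (up-left lt u eq) = refl , subst (Lab t′ i)
      (cong₂ _+_ (bwd-up i<n u) (trans (others (suc i) λ ()) (sym eq)))
      (up-right lt u (trans fired (cong suc (trans eq (sym (others (suc i) λ ()))))))
    fire-right (down-left lt u eq) = refl , subst (Lab t′ i)
      (trans (cong (bwd (suc i) +_) (trans (others (suc i) λ ()) eq))
        (trans (+-suc (bwd (suc i)) (t i)) (cong (_+ t i) (bwd-down i<n u))))
      (down-right lt u (trans (others (suc i) λ ()) (trans eq (sym fired))))
    -- Here it is the turn of column i + 1: firing column i again would put it two ahead.
    fire-right (up-right lt u eq) = ⊥-elim (¬Lead-2+
      (subst₂ Lead (trans fired (cong suc eq)) (others (suc i) λ ()) (proj₁ (after i lt) u)))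
    fire-right (down-right lt u eq) = ⊥-elim (¬Lead-suc
      (subst₂ Lead (trans (others (suc i) λ ()) eq) fired (proj₂ (after i lt) u)))

    fire-other : ∀ {g x} → i ≢ g → i ≢ suc g → Lab t g x → Lab t′ g x
    fire-other i≢g i≢1+g = Lab-cong (sym (others _ i≢g)) (λ _ → sym (others _ i≢1+g))

  fire-left : ∀ {t t′ g x} → Fire t t′ (suc g) → Lab t g x →
    x ≡ bwd (suc g) + t (suc g) × Lab t′ g (asc (suc g) + t (suc g))
  fire-left {t} {t′} {g} fire = go
    where
    open Fire fire
    same : t′ g ≡ t g
    same = others g λ ()
    go : ∀ {x} → Lab t g x → x ≡ bwd (suc g) + t (suc g) × Lab t′ g (asc (suc g) + t (suc g))
    go (wall eq) = ⊥-elim (<-irrefl eq i<n)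
    go (up-right lt u eq) = refl , subst (Lab t′ g)
      (trans (cong (asc g +_) (trans same eq)) (trans (+-suc (asc g) (t (suc g))) (cong (_+ t (suc g)) (sym (asc-up u)))))
      (up-left lt u (trans same (trans eq (sym fired))))
    go (down-right lt u eq) = refl , subst (Lab t′ g)
      (cong₂ _+_ (sym (asc-down u)) (trans same (sym eq)))
      (down-left lt u (trans fired (cong suc (trans eq (sym same)))))
    go (up-left lt u eq) = ⊥-elim (¬Lead-suc
      (subst₂ Lead (trans same eq) fired (proj₁ (after g lt) u)))
    go (down-left lt u eq) = ⊥-elim (¬Lead-2+
      (subst₂ Lead (trans fired (cong suc eq)) same (proj₂ (after g lt) u)))

  module _ {X : Set} (π : ℕ → X) where

    -- The map `π` is reduction modulo n + 1 in type A and the identity in type B.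
    Gaps : (ℕ → ℕ) → (Fin n → X) → Set
    Gaps t v = ∀ g → ∃ λ x → Lab t (toℕ g) x × v g ≡ π x

    -- Column i + 1 lies between the gaps i and i + 1. By `fire-left` and `fire-right`, the label
    -- required on each side after the crossing is the one found on the other side before it.
    gaps-swap : ∀ {t t′ v v′} (i : Fin m) → Fire t t′ (suc (toℕ i)) → (∀ g → v′ g ≡ v (σ i g)) →
      Gaps t v → Gaps t′ v′
    gaps-swap {t} {t′} {v} {v′} i fire v′≡ gaps g = result (σ-view i g) (v′≡ g)
      where
      result : ∀ {g h} → σ-View i g h → v′ g ≡ v h → ∃ λ x → Lab t′ (toℕ g) x × v′ g ≡ π x
      result left eq =
        let x , lab , vx = gaps (suc i)
            y , lab′ , _ = gaps (inject₁ i)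
        in x , subst₂ (Lab t′) (sym (Finₚ.toℕ-inject₁ i)) (sym (proj₁ (fire-right fire lab)))
                 (proj₂ (fire-left fire (subst (λ j → Lab t j y) (Finₚ.toℕ-inject₁ i) lab′))) , trans eq vx
      result right eq =
        let x , lab , vx = gaps (inject₁ i)
            y , lab′ , _ = gaps (suc i)
        in x , subst (Lab t′ (suc (toℕ i)))
                 (sym (proj₁ (fire-left fire (subst (λ j → Lab t j x) (Finₚ.toℕ-inject₁ i) lab))))
                 (proj₂ (fire-right fire lab′)) , trans eq vx
      result {g} (fixed ≢i ≢1+i) eq =
        let x , lab , vx = gaps g
        in x , fire-other fire (≢1+i ∘ sym) (≢i ∘ sym ∘ suc-injective) lab , trans eq vx

    -- Column 0 has a gap only on its right. The incoming wire stems from position 0 in type A and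
    -- from the sign change in type B, so its value is a hypothesis.
    gaps-head : ∀ {t t′ v v′} → Fire t t′ 0 → v′ zero ≡ π (bwd 0 + t 0) → (∀ g → v′ (suc g) ≡ v (suc g)) →
      Gaps t v → Gaps t′ v′
    gaps-head fire v′0 v′s gaps zero =
      _ , proj₂ (fire-right fire (proj₁ (proj₂ (gaps zero)))) , v′0
    gaps-head fire v′0 v′s gaps (suc g) =
      let x , lab , vx = gaps (suc g)
      in x , fire-other fire (λ ()) (λ ()) lab , trans (v′s g) vx

    gaps-zero : ∀ {t t′ v} → Fire t t′ 0 → Gaps t v → v zero ≡ π (t 0)
    gaps-zero fire gaps =
      let x , lab , vx = gaps zero in trans vx (cong π (proj₁ (fire-right fire lab)))

  data Legal : List (Fin n) → Set where
    []   : Legal []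
    snoc : ∀ {xs} → Legal xs → ∀ i → Interlaced (λ j → count j (xs ∷ʳ i)) → Legal (xs ∷ʳ i)

  snoc-fire : ∀ {xs} i → Interlaced (λ j → count j (xs ∷ʳ i)) →
    Fire (λ j → count j xs) (λ j → count j (xs ∷ʳ i)) (toℕ i)
  snoc-fire {xs} i after = record
    { i<n = Finₚ.toℕ<n i ; fired = count-∷ʳ-hit xs i ; others = λ j → count-∷ʳ-miss xs
    ; after = after }

  initial : ∀ g → g < n → ∃ (Lab (λ _ → 0) g)
  initial g g<n with m≤n⇒m<n∨m≡n g<n
  ... | inj₂ eq = _ , wall eq
  ... | inj₁ lt with up g in eq
  ...   | true  = _ , up-left lt eq refl
  ...   | false = _ , down-right lt eq refl

  -- From left to right, the ascending gaps start with 0, 1, 2, ... and the descending ones with n -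
  -- 1, n - 2, ...; the gap at the wall receives the one value left, `asc m`. This is why initial
  -- labels are distinct and below n.
  data Initial (g x : ℕ) : Set where
    ascending  : x ≡ asc g → suc g ≡ n ⊎ up g ≡ true → Initial g x
    descending : x ≡ bwd (suc g) → suc g < n → up g ≡ false → Initial g x

  Lab⇒Initial : ∀ {g x} → Lab (λ _ → 0) g x → Initial g x
  Lab⇒Initial {g} (wall eq)           = ascending (+-identityʳ (asc g)) (inj₁ eq)
  Lab⇒Initial {g} (up-left lt u _)    = ascending (+-identityʳ (asc g)) (inj₂ u)
  Lab⇒Initial {g} (down-right lt u _) = descending (+-identityʳ (bwd (suc g))) lt u

  Initial⇒< : ∀ {g x} → g < n → Initial g x → x < n
  Initial⇒< {g} g<n (ascending refl _) =
    ≤-<-trans (m≤m+n (asc g) (desc g)) (≤-<-trans (≤-reflexive (asc+desc g)) g<n)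
  Initial⇒< {g} g<n (descending refl lt u) = begin-strict
    bwd (suc g)                   <⟨ m<m+n (bwd (suc g)) (s≤s z≤n) ⟩
    bwd (suc g) + suc (desc g)    ≡⟨ cong (bwd (suc g) +_) (sym (desc-down u)) ⟩
    bwd (suc g) + desc (suc g)    ≡⟨ bwd+desc g<n ⟩
    n                             ∎
    where open ≤-Reasoning

  Initial-distinct : ∀ {g h x} → g < h → h < n → Initial g x → ¬ Initial h x
  Initial-distinct g<h h<n (ascending _ (inj₁ refl)) _ = <⇒≱ g<h (≤-pred h<n)
  Initial-distinct {g} {h} g<h h<n (ascending refl (inj₂ u)) (ascending eq _) =
    <-irrefl eq (≤-trans (≤-reflexive (sym (asc-up u))) (asc-mono h g<h))
  Initial-distinct {g} {h} g<h h<n (ascending refl (inj₂ u)) (descending eq lt d) = <-irrefl refl (begin-strict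
    n                            ≡⟨ bwd+desc h<n ⟨
    bwd (suc h) + desc (suc h)   ≡⟨ cong (_+ desc (suc h)) eq ⟨
    asc g + desc (suc h)         ≤⟨ +-monoˡ-≤ (desc (suc h)) (asc-mono (suc h) (m≤n⇒m≤1+n (<⇒≤ g<h))) ⟩
    asc (suc h) + desc (suc h)   ≡⟨ asc+desc (suc h) ⟩
    suc h                        <⟨ lt ⟩
    n                            ∎)
    where open ≤-Reasoning
  Initial-distinct {g} {h} g<h h<n (descending refl lt d) (ascending eq _) = <-irrefl refl (begin-strict
    n                            ≡⟨ bwd+desc (<⇒≤ lt) ⟨
    bwd (suc g) + desc (suc g)   ≡⟨ cong (_+ desc (suc g)) eq ⟩
    asc h + desc (suc g)         ≤⟨ +-monoʳ-≤ (asc h) (desc-mono h g<h) ⟩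
    asc h + desc h               ≡⟨ asc+desc h ⟩
    h                            <⟨ h<n ⟩
    n                            ∎)
    where open ≤-Reasoning
  Initial-distinct {g} {h} g<h h<n (descending refl lt d) (descending eq lt′ d′) = <-irrefl refl (begin-strict
    n                            ≡⟨ bwd+desc (<⇒≤ lt) ⟨
    bwd (suc g) + desc (suc g)   ≡⟨ cong (_+ desc (suc g)) eq ⟩
    bwd (suc h) + desc (suc g)   ≤⟨ +-monoʳ-≤ (bwd (suc h)) (desc-mono h g<h) ⟩
    bwd (suc h) + desc h         <⟨ +-monoʳ-< (bwd (suc h)) ≤-refl ⟩
    bwd (suc h) + suc (desc h)   ≡⟨ cong (bwd (suc h) +_) (desc-down d′) ⟨
    bwd (suc h) + desc (suc h)   ≡⟨ bwd+desc h<n ⟩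
    n                            ∎)
    where open ≤-Reasoning

  init : Fin n → ℕ
  init g = proj₁ (initial (toℕ g) (Finₚ.toℕ<n g))

  init-Lab : ∀ g → Lab (λ _ → 0) (toℕ g) (init g)
  init-Lab g = proj₂ (initial (toℕ g) (Finₚ.toℕ<n g))

  init< : ∀ g → init g < n
  init< g = Initial⇒< (Finₚ.toℕ<n g) (Lab⇒Initial (init-Lab g))

  init-injective : ∀ g h → init g ≡ init h → g ≡ h
  init-injective g h eq with <-cmp (toℕ g) (toℕ h)
  ... | tri≈ _ g≡h _ = Finₚ.toℕ-injective g≡h
  ... | tri< g<h _ _ = ⊥-elim (Initial-distinct g<h (Finₚ.toℕ<n h) (Lab⇒Initial (init-Lab g))
                         (subst (Initial (toℕ h)) (sym eq) (Lab⇒Initial (init-Lab h))))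
  ... | tri> _ _ h<g = ⊥-elim (Initial-distinct h<g (Finₚ.toℕ<n g) (Lab⇒Initial (init-Lab h))
                         (subst (Initial (toℕ g)) eq (Lab⇒Initial (init-Lab g))))

  -- Let j′ = m - j be the mirrored column. Then asc j + targetA j = bwd j′ and bwd j + targetA j =
  -- asc j′ + (n + 1): after so many firings, the labels due at column j are those of the first
  -- crossing of column j′, exchanged.
  targetA : ℕ → ℕ
  targetA j = suc (desc j + asc (m ∸ j))

  -- From g + 1 back to g, the value rises by one if the mirrored gap h ascends and falls by one if
  -- g descends.
  targetA-interlaced : Interlaced targetA
  targetA-interlaced g 1+g<n = ups , downs
    where
    h = m ∸ suc g
    m∸g : m ∸ g ≡ suc h
    m∸g = +-∸-assoc 1 (≤-pred 1+g<n)
    ups : up g ≡ true → Lead (targetA g) (targetA (suc g))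
    ups u rewrite desc-up u | m∸g with up h
    ... | true  = inj₂ (cong suc (+-suc (desc g) (asc h)))
    ... | false = inj₁ refl
    downs : up g ≡ false → Lead (targetA (suc g)) (targetA g)
    downs u rewrite desc-down u | m∸g with up h
    ... | true  = inj₁ (cong suc (sym (+-suc (desc g) (asc h))))
    ... | false = inj₂ refl

  targetA≤n : ∀ {j} → j < n → targetA j ≤ n
  targetA≤n {j} j<n = s≤s (begin
    desc j + asc (m ∸ j)     ≤⟨ +-mono-≤ (≤-trans (m≤n+m (desc j) (asc j)) (≤-reflexive (asc+desc j)))
                                  (≤-trans (m≤m+n (asc (m ∸ j)) (desc (m ∸ j))) (≤-reflexive (asc+desc (m ∸ j)))) ⟩
    j + (m ∸ j)              ≡⟨ m+[n∸m]≡n (≤-pred j<n) ⟩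
    m                        ∎)
    where open ≤-Reasoning

  -- The gaps g and h are mirror images. Comparing `targetA g` with `targetA (suc g)` shows that
  -- column g is due at the end exactly when its mirror h + 1 is due at the start. The labels then
  -- agree by `leftward`, or by `rightward` up to one full turn n + 1.
  finalA-gap : ∀ {g h x y} → g + suc h ≡ m → Lab targetA g x → Lab (λ _ → 0) h y → x % suc n ≡ y % suc n
  finalA-gap {g} {h} g+1+h≡m lab lab₀ = cases lab lab₀
    where
    h<n : suc h < n
    h<n = s≤s (subst (suc h ≤_) g+1+h≡m (m≤n+m (suc h) g))
    m∸g : m ∸ g ≡ suc h
    m∸g = trans (cong (_∸ g) (sym g+1+h≡m)) (m+n∸m≡n g (suc h))
    m∸1+g : m ∸ suc g ≡ h
    m∸1+g = trans (cong (_∸ suc g) (trans (sym g+1+h≡m) (+-suc g h))) (m+n∸m≡n g h)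
    n∸1+h : n ∸ suc h ≡ suc g
    n∸1+h = trans (cong (_∸ h) (trans (sym g+1+h≡m) (+-suc g h))) (m+n∸n≡m (suc g) h)
    g<n : suc g ≤ n
    g<n = s≤s (subst (g ≤_) g+1+h≡m (m≤m+n g (suc h)))
    leftward : asc g + targetA g ≡ suc g + asc (suc h)
    leftward rewrite m∸g = trans (+-suc (asc g) _) (cong suc
      (trans (sym (+-assoc (asc g) (desc g) (asc (suc h)))) (cong (_+ asc (suc h)) (asc+desc g))))
    rightward : bwd (suc g) + targetA (suc g) ≡ asc h + suc n
    rightward rewrite m∸1+g = begin
      bwd (suc g) + suc (desc (suc g) + asc h)
        ≡⟨ solve 3 (λ b d a → b :+ (con 1 :+ (d :+ a)) := a :+ (con 1 :+ (b :+ d))) refl (bwd (suc g)) (desc (suc g)) (asc h) ⟩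
      asc h + suc (bwd (suc g) + desc (suc g))
        ≡⟨ cong (λ k → asc h + suc k) (bwd+desc g<n) ⟩
      asc h + suc n ∎
      where open ≡-Reasoning
            open +-*-Solver
    descending-label : suc g + asc (suc h) ≡ bwd (suc h) + 0
    descending-label rewrite n∸1+h = trans (+-comm (suc g) (asc (suc h))) (sym (+-identityʳ _))
    down-case : ∀ {y} → up h ≡ false → Lab (λ _ → 0) h y → (asc g + targetA g) % suc n ≡ y % suc n
    down-case d (down-right _ _ _) = cong (_% suc n) (trans leftward descending-label)
    down-case d (wall eq) = ⊥-elim (<-irrefl eq h<n)
    down-case d (up-left _ u _) with () ← trans (sym u) d
    up-case : ∀ {y} → up h ≡ true → Lab (λ _ → 0) h y → (bwd (suc g) + targetA (suc g)) % suc n ≡ y % suc n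
    up-case u (up-left _ _ _) = trans (cong (_% suc n) rightward)
      (trans ([m+n]%n≡m%n (asc h) (suc n)) (cong (_% suc n) (sym (+-identityʳ (asc h)))))
    up-case u (wall eq) = ⊥-elim (<-irrefl eq h<n)
    up-case u (down-right _ d _) with () ← trans (sym u) d
    asc-up≢ : up h ≡ true → asc (suc h) ≢ asc h
    asc-up≢ u eq = 1+n≢n (trans (sym (asc-up u)) eq)
    asc-down≢ : up h ≡ false → asc (suc h) ≢ suc (asc h)
    asc-down≢ d eq = 1+n≢n (trans (sym eq) (asc-down d))
    target-g : targetA g ≡ suc (desc g + asc (suc h))
    target-g = cong (λ k → suc (desc g + asc k)) m∸g
    target-up : up g ≡ true → targetA (suc g) ≡ suc (desc g + asc h)
    target-up u = cong₂ (λ d k → suc (d + asc k)) (desc-up u) m∸1+g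
    target-down : up g ≡ false → targetA (suc g) ≡ suc (suc (desc g + asc h))
    target-down d = cong₂ (λ d k → suc (d + asc k)) (desc-down d) m∸1+g
    cases : ∀ {x y} → Lab targetA g x → Lab (λ _ → 0) h y → x % suc n ≡ y % suc n
    cases (wall eq) _ = ⊥-elim (1+n≢0 (+-cancelˡ-≡ g (suc h) 0
      (trans g+1+h≡m (trans (sym (suc-injective eq)) (sym (+-identityʳ g))))))
    cases (up-left lt u eq) lab with up h in uh
    ... | false = down-case uh lab
    ... | true  = ⊥-elim (asc-up≢ uh (+-cancelˡ-≡ (desc g) _ _ (suc-injective
                    (trans (sym target-g) (trans eq (target-up u))))))
    cases (down-left lt d eq) lab with up h in uh
    ... | false = down-case uh lab
    ... | true  = ⊥-elim (asc-up≢ uh (sym (+-cancelˡ-≡ (desc g) _ _ (suc-injective (suc-injective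
                    (trans (sym (target-down d)) (trans eq (cong suc target-g))))))))
    cases (up-right lt u eq) lab with up h in uh
    ... | true  = up-case uh lab
    ... | false = ⊥-elim (asc-down≢ uh (+-cancelˡ-≡ (desc g) _ _ (trans (suc-injective
                    (trans (sym target-g) (trans eq (cong suc (target-up u))))) (sym (+-suc (desc g) (asc h))))))
    cases (down-right lt d eq) lab with up h in uh
    ... | true  = up-case uh lab
    ... | false = ⊥-elim (asc-down≢ uh (sym (+-cancelˡ-≡ (desc g) _ _ (trans (+-suc (desc g) (asc h)) (suc-injective
                    (trans (sym (target-down d)) (trans eq target-g)))))))

-- The longest elements

foldl-swapAdj-map : {X Y : Set} {n : ℕ} (f : X → Y) (v : Vec X (suc n)) (xs : List (Fin n)) →
  foldl swapAdj (Vec.map f v) xs ≡ Vec.map f (foldl swapAdj v xs)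
foldl-swapAdj-map f v []       = refl
foldl-swapAdj-map f v (x ∷ xs) =
  trans (cong (λ w → foldl swapAdj w xs) (sym (map-swapAdj f v x))) (foldl-swapAdj-map f (swapAdj v x) xs)

-- Swapping positions is blind to the entries, so the effect on `allFin` determines the effect on
-- every vector.
foldl-swapAdj-lookup : {X : Set} {n : ℕ} (v : Vec X (suc n)) (xs : List (Fin n)) (i : Fin (suc n)) →
  lookup (foldl swapAdj v xs) i ≡ lookup v (lookup (foldl swapAdj (Vec.allFin (suc n)) xs) i)
foldl-swapAdj-lookup {n = n} v xs i = trans
  (cong (λ w → lookup (foldl swapAdj w xs) i) (trans (sym (tabulate∘lookup v)) (tabulate-∘ (lookup v) id)))
  (trans (cong (λ w → lookup w i) (foldl-swapAdj-map (lookup v) (Vec.allFin (suc n)) xs))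
         (lookup-map i (lookup v) (foldl swapAdj (Vec.allFin (suc n)) xs)))

-- The type B action with the sign change left open: it becomes negation on signed entries, addition
-- of n on labels and a successor on flip counts.
actG : {X : Set} {n : ℕ} → (X → X) → Vec X n → Fin n → Vec X n
actG ι (x ∷ xs) zero    = ι x ∷ xs
actG ι (x ∷ xs) (suc t) = swapAdj (x ∷ xs) t

actB≡actG : ∀ {n} (v : GB n) t → actB v t ≡ actG neg v t
actB≡actG (x ∷ xs) zero    = refl
actB≡actG (x ∷ xs) (suc t) = swapVec≡swapAdj (x ∷ xs) t

map-actG : {X Y : Set} {n : ℕ} (f : X → Y) {ι : X → X} {κ : Y → Y} → (∀ x → f (ι x) ≡ κ (f x)) →
  (v : Vec X n) (t : Fin n) → Vec.map f (actG ι v t) ≡ actG κ (Vec.map f v) t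
map-actG f eq (x ∷ xs) zero    = cong (_∷ _) (eq x)
map-actG f eq (x ∷ xs) (suc t) = map-swapAdj f (x ∷ xs) t

foldl-actG-map : {X Y : Set} {n : ℕ} (f : X → Y) {ι : X → X} {κ : Y → Y} → (∀ x → f (ι x) ≡ κ (f x)) →
  (v : Vec X n) (xs : List (Fin n)) → foldl (actG κ) (Vec.map f v) xs ≡ Vec.map f (foldl (actG ι) v xs)
foldl-actG-map f eq v []       = refl
foldl-actG-map f {ι} {κ} eq v (x ∷ xs) = trans
  (cong (λ w → foldl (actG κ) w xs) (sym (map-actG f eq v x))) (foldl-actG-map f eq (actG ι v x) xs)

module LongestWord (m : ℕ) (up : ℕ → Bool) where
  open Labels m up

  private
    n = suc m

  -- Position 0 lies left of all gaps; its label n is bwd 0, under which its wire enters column 0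
  -- for the first time.
  labelsA : Fin (suc n) → ℕ
  labelsA zero    = n
  labelsA (suc g) = init g

  labelsA≤n : ∀ i → labelsA i < suc n
  labelsA≤n zero    = ≤-refl
  labelsA≤n (suc g) = m<n⇒m<1+n (init< g)

  labelsA-injective : ∀ i j → labelsA i ≡ labelsA j → i ≡ j
  labelsA-injective zero    zero    eq = refl
  labelsA-injective zero    (suc h) eq = ⊥-elim (<-irrefl (sym eq) (init< h))
  labelsA-injective (suc g) zero    eq = ⊥-elim (<-irrefl eq (init< g))
  labelsA-injective (suc g) (suc h) eq = cong suc (init-injective g h eq)

  wiresA : List (Fin n) → Vec ℕ (suc n)
  wiresA = foldl swapAdj (Vec.tabulate labelsA)

  wiresA-∷ʳ : ∀ xs x i → lookup (wiresA (xs ∷ʳ x)) i ≡ lookup (wiresA xs) (σ x i)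
  wiresA-∷ʳ xs x i = trans (cong (λ w → lookup w i) (foldl-∷ʳ swapAdj _ x xs)) (lookup-swapAdj (wiresA xs) x i)

  -- Each firing of column 0 sends the wire t 0 to position 0, and that wire comes back as n + (t 0
  -- + 1). The two labels agree modulo n + 1, which is the reason for the modulus.
  wiresA-labelled : ∀ {xs} → Legal xs →
    lookup (wiresA xs) zero ≡ (n + count 0 xs) % suc n ×
    Gaps (_% suc n) (λ j → count j xs) (λ g → lookup (wiresA xs) (suc g))
  wiresA-labelled [] = sym (trans (cong (_% suc n) (+-identityʳ n)) (m<n⇒m%n≡m ≤-refl)) ,
    λ g → init g , init-Lab g , trans (lookup∘tabulate labelsA (suc g)) (sym (m<n⇒m%n≡m (labelsA≤n (suc g))))
  wiresA-labelled (snoc {xs} legal zero after) =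
    let head , gaps = wiresA-labelled legal
        fire = snoc-fire {xs} zero after
    in trans (wiresA-∷ʳ xs zero zero) (trans (gaps-zero (_% suc n) fire gaps)
         (trans (sym ([m+n]%n≡m%n (count 0 xs) (suc n)))
           (cong (_% suc n) (trans (+-suc (count 0 xs) n) (trans (cong suc (+-comm (count 0 xs) n))
             (trans (sym (+-suc n (count 0 xs))) (cong (n +_) (sym (count-∷ʳ-hit xs zero))))))))) ,
       gaps-head (_% suc n) fire (trans (wiresA-∷ʳ xs zero (suc zero)) head)
         (λ g → wiresA-∷ʳ xs zero (suc (suc g))) gaps
  wiresA-labelled (snoc {xs} legal (suc i) after) =
    let head , gaps = wiresA-labelled legal
        fire = snoc-fire {xs} (suc i) after
    in trans (wiresA-∷ʳ xs (suc i) zero) (trans head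
         (cong (λ k → (n + k) % suc n) (sym (count-∷ʳ-miss {j = 0} xs {suc i} λ ())))) ,
       gaps-swap (_% suc n) i fire (λ g → wiresA-∷ʳ xs (suc i) (suc g)) gaps

  module _ {xs : List (Fin n)} (legal : Legal xs) (counts : ∀ j → j < n → count j xs ≡ targetA j) where

    -- The two extreme positions lie at the walls and are computed directly; all others are matched
    -- by `finalA-gap`.
    wiresA-reversed : ∀ i → lookup (wiresA xs) i ≡ labelsA (opposite i)
    wiresA-reversed zero = begin
      lookup (wiresA xs) zero                          ≡⟨ proj₁ (wiresA-labelled legal) ⟩
      (n + count 0 xs) % suc n                         ≡⟨ cong (λ k → (n + k) % suc n) (counts 0 (s≤s z≤n)) ⟩
      (n + suc (asc m)) % suc n                        ≡⟨ cong (_% suc n) (trans (+-suc n (asc m)) (+-comm (suc n) (asc m))) ⟩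
      (asc m + suc n) % suc n                          ≡⟨ [m+n]%n≡m%n (asc m) (suc n) ⟩
      asc m % suc n                                    ≡⟨ cong (_% suc n) (last-label (init-Lab (fromℕ m))) ⟨
      init (fromℕ m) % suc n                           ≡⟨ m<n⇒m%n≡m (labelsA≤n (suc (fromℕ m))) ⟩
      init (fromℕ m)                                   ∎
      where
      open ≡-Reasoning
      last-label : ∀ {x} → Lab (λ _ → 0) (toℕ (fromℕ m)) x → x ≡ asc m
      last-label lab with toℕ (fromℕ m) | Finₚ.toℕ-fromℕ m | Lab⇒Initial lab
      ... | _ | refl | ascending eq _     = eq
      ... | _ | refl | descending _ lt _  = ⊥-elim (<-irrefl refl lt)
    wiresA-reversed (suc g) =
      let x , lab , eq = proj₂ (wiresA-labelled legal) g in
      trans eq (gap x (Lab-cong (counts (toℕ g) (Finₚ.toℕ<n g)) (counts (suc (toℕ g))) lab)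
        (opposite (suc g)) (Finₚ.opposite-prop (suc g)))
      where
      g≤m : toℕ g ≤ m
      g≤m = ≤-pred (Finₚ.toℕ<n g)
      gap : ∀ x → Lab targetA (toℕ g) x → ∀ i → toℕ i ≡ m ∸ toℕ g → x % suc n ≡ labelsA i
      gap x lab (suc h) eq = trans
        (finalA-gap (trans (cong (toℕ g +_) eq) (m+[n∸m]≡n g≤m)) lab (init-Lab h))
        (m<n⇒m%n≡m (labelsA≤n (suc h)))
      gap x lab zero eq = trans (cong (_% suc n) (last lab)) (m<n⇒m%n≡m ≤-refl)
        where
        g≡m : toℕ g ≡ m
        g≡m = ≤-antisym g≤m (m∸n≡0⇒m≤n (sym eq))
        last : ∀ {x} → Lab targetA (toℕ g) x → x ≡ n
        last (wall _) = trans (+-suc (asc (toℕ g)) _) (cong suc (trans (cong (λ k → asc (toℕ g) + (desc (toℕ g) + asc k)) (sym eq))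
          (trans (cong (asc (toℕ g) +_) (+-identityʳ (desc (toℕ g)))) (trans (asc+desc (toℕ g)) g≡m))))
        last (up-left lt _ _)    = ⊥-elim (<-irrefl (cong suc g≡m) lt)
        last (down-left lt _ _)  = ⊥-elim (<-irrefl (cong suc g≡m) lt)
        last (up-right lt _ _)   = ⊥-elim (<-irrefl (cong suc g≡m) lt)
        last (down-right lt _ _) = ⊥-elim (<-irrefl (cong suc g≡m) lt)

    -- Distinct labels reveal the permutation of positions that the word induces. An arbitrary `v`
    -- is allowed because ψ needs the action on w∘⁻¹ s.
    foldl-actA-reverses : ∀ (v : GA n) i → lookup (foldl actA v xs) i ≡ lookup v (opposite i)
    foldl-actA-reverses v i = trans (cong (λ w → lookup w i) (foldl-cong swapVec≡swapAdj v xs))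
      (trans (foldl-swapAdj-lookup v xs i) (cong (lookup v) (labelsA-injective _ _
        (trans (sym (lookup∘tabulate labelsA (lookup (foldl swapAdj (Vec.allFin (suc n)) xs) i)))
          (trans (sym (foldl-swapAdj-lookup (Vec.tabulate labelsA) xs i)) (wiresA-reversed i))))))

  wiresB : List (Fin n) → Vec ℕ n
  wiresB = foldl (actG (_+ n)) (Vec.tabulate init)

  wiresB-labelled : ∀ {xs} → Legal xs → Gaps id (λ j → count j xs) (lookup (wiresB xs))
  wiresB-labelled [] g = init g , init-Lab g , lookup∘tabulate init g
  wiresB-labelled (snoc {xs} legal i after) =
    step {v = wiresB xs} i (snoc-fire {xs} i after) (foldl-∷ʳ (actG (_+ n)) _ i xs) (wiresB-labelled legal)
    where
    step : ∀ {t t′ v v′} i → Fire t t′ (toℕ i) → v′ ≡ actG (_+ n) v i → Gaps id t (lookup v) → Gaps id t′ (lookup v′)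
    -- Column 0 turns asc 0 + t 0 = t 0 into bwd 0 + t 0 = n + t 0, so a sign change is exactly the
    -- addition of n.
    step {t} {v = x ∷ v} zero fire refl gaps = gaps-head id fire
      (trans (cong (_+ n) (gaps-zero id fire gaps)) (+-comm (t 0) n)) (λ g → refl) gaps
    step {v = x ∷ v} (suc i) fire refl gaps = gaps-swap id i fire (lookup-swapAdj (x ∷ v) i) gaps

  -- All columns are level at the end as at the start, so the same column is due and its label has
  -- grown by n.
  finalB-gap : ∀ {g x y} → Lab (λ _ → n) g x → Lab (λ _ → 0) g y → x ≡ y + n
  finalB-gap (up-right _ _ eq) _ = ⊥-elim (1+n≢n (sym eq))
  finalB-gap (down-left _ _ eq) _ = ⊥-elim (1+n≢n (sym eq))
  finalB-gap {g} (wall eq) lab with Lab⇒Initial lab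
  ... | ascending refl _ = refl
  ... | descending _ lt _ = ⊥-elim (<-irrefl eq lt)
  finalB-gap {g} (up-left lt u _) lab with Lab⇒Initial lab
  ... | ascending refl _ = refl
  ... | descending _ _ d with () ← trans (sym u) d
  finalB-gap {g} (down-right lt d _) lab with Lab⇒Initial lab
  ... | descending refl _ _ = refl
  ... | ascending _ (inj₁ eq) = ⊥-elim (<-irrefl eq lt)
  ... | ascending _ (inj₂ u) with () ← trans (sym u) d

  -- Counting sign changes instead of recording their parity makes the
  -- labels exact natural numbers, so no reduction modulo 2n is needed.
  countFlips : List (Fin n) → Vec (ℕ × Fin n) n
  countFlips = foldl (actG (map₁ suc)) (Vec.tabulate (0 ,_))

  foldl-actG-lookup : {X : Set} (ι : X → X) (v : Vec X n) (f : ℕ × Fin n → X) →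
    (∀ j → f (0 , j) ≡ lookup v j) → (∀ k j → f (suc k , j) ≡ ι (f (k , j))) →
    ∀ xs i → lookup (foldl (actG ι) v xs) i ≡ f (lookup (countFlips xs) i)
  foldl-actG-lookup ι v f f-zero f-suc xs i = trans
    (cong (λ w → lookup (foldl (actG ι) w xs) i)
      (trans (sym (tabulate∘lookup v)) (trans (tabulate-cong (sym ∘ f-zero)) (tabulate-∘ f (0 ,_)))))
    (trans (cong (λ w → lookup w i) (foldl-actG-map f {map₁ suc} {ι} (λ (k , j) → f-suc k j) (Vec.tabulate (0 ,_)) xs))
           (lookup-map i f (countFlips xs)))

  module _ {xs : List (Fin n)} (legal : Legal xs) (counts : ∀ j → j < n → count j xs ≡ n) where

    countFlips-once : ∀ i → lookup (countFlips xs) i ≡ (1 , i)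
    countFlips-once i = unique (lookup (countFlips xs) i) (trans (sym label) shifted)
      where
      label : lookup (wiresB xs) i ≡ init (proj₂ (lookup (countFlips xs) i)) + proj₁ (lookup (countFlips xs) i) * n
      label = foldl-actG-lookup (_+ n) (Vec.tabulate init) (λ (k , j) → init j + k * n)
        (λ j → trans (+-identityʳ (init j)) (sym (lookup∘tabulate init j)))
        (λ k j → trans (cong (init j +_) (+-comm n (k * n))) (sym (+-assoc (init j) (k * n) n))) xs i
      shifted : lookup (wiresB xs) i ≡ init i + 1 * n
      shifted =
        let x , lab , eq = wiresB-labelled legal i in
        trans eq (trans (finalB-gap (Lab-cong (counts (toℕ i) (Finₚ.toℕ<n i)) (counts (suc (toℕ i))) lab) (init-Lab i))
          (cong (init i +_) (sym (+-identityʳ n))))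
      -- Initial labels are below n: the remainder modulo n determines j, and then the quotient
      -- determines k.
      unique : ∀ kj → init (proj₂ kj) + proj₁ kj * n ≡ init i + 1 * n → kj ≡ (1 , i)
      unique (k , j) eq with init-injective j i (trans (sym (m<n⇒m%n≡m (init< j)))
          (trans (sym ([m+kn]%n≡m%n (init j) k n)) (trans (cong (_% n) eq)
            (trans ([m+kn]%n≡m%n (init i) 1 n) (m<n⇒m%n≡m (init< i))))))
      ... | refl = cong (_, i) (*-cancelʳ-≡ k 1 n (+-cancelˡ-≡ (init i) _ _ eq))

    foldl-actB-negates : ∀ (v : GB n) i → lookup (foldl actB v xs) i ≡ neg (lookup v i)
    foldl-actB-negates v i = trans (cong (λ w → lookup w i) (foldl-cong actB≡actG v xs))
      (trans (foldl-actG-lookup neg v flips (λ _ → refl) (λ _ _ → refl) xs i) (cong flips (countFlips-once i)))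
      where
      flips : ℕ × Fin n → Bool × Fin n
      flips (zero  , j) = lookup v j
      flips (suc k , j) = neg (flips (k , j))

-- Reading the positions of c c c ⋯

injective⇒surjective : ∀ {n} (f : Fin n → Fin n) → (∀ i j → f i ≡ f j → i ≡ j) → ∀ j → ∃ λ i → f i ≡ j
injective⇒surjective {suc n} f inj j with Finₚ.any? (λ i → f i Fin.≟ j)
... | yes found = found
... | no missing = ⊥-elim (1+n≰n (Finₚ.injective⇒≤ {f = λ i → Fin.punchOut (avoids i)}
        λ {i} {k} eq → inj i k (Finₚ.punchOut-injective (avoids i) (avoids k) eq)))
  where
  avoids : ∀ i → j ≢ f i
  avoids i eq = missing (i , sym eq)

suc-/% : ∀ p n .{{_ : NonZero n}} →
  (suc p / n ≡ p / n × suc p % n ≡ suc (p % n)) ⊎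
  (suc (p % n) ≡ n × suc p / n ≡ suc (p / n) × suc p % n ≡ 0)
suc-/% p n = cases (m≤n⇒m<n∨m≡n (m%n<n p n))
  where
  suc-p : suc p ≡ suc (p % n) + p / n * n
  suc-p = cong suc (m≡m%n+[m/n]*n p n)
  quot : suc p / n ≡ suc (p % n) / n + p / n
  quot = trans (cong (_/ n) suc-p) (trans (+-distrib-/-∣ʳ (suc (p % n)) (n∣m*n (p / n)))
    (cong (suc (p % n) / n +_) (m*n/n≡m (p / n) n)))
  rem : suc p % n ≡ suc (p % n) % n
  rem = trans (cong (_% n) suc-p) ([m+kn]%n≡m%n (suc (p % n)) (p / n) n)
  cases : suc (p % n) < n ⊎ suc (p % n) ≡ n →
    (suc p / n ≡ p / n × suc p % n ≡ suc (p % n)) ⊎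
    (suc (p % n) ≡ n × suc p / n ≡ suc (p / n) × suc p % n ≡ 0)
  cases (inj₁ lt) = inj₁ (trans quot (cong (_+ p / n) (m<n⇒m/n≡0 lt)) , trans rem (m<n⇒m%n≡m lt))
  cases (inj₂ eq) = inj₂ (eq , trans quot (cong (_+ p / n) (trans (cong (_/ n) eq) (n/n≡1 n))) ,
                          trans rem (trans (cong (_% n) eq) (n%n≡0 n)))

Lead-intro : ∀ {x y} → y ≤ x → x ≤ suc y → Lead x y
Lead-intro y≤x x≤1+y with m≤n⇒m<n∨m≡n y≤x
... | inj₁ y<x  = inj₂ (≤-antisym x≤1+y y<x)
... | inj₂ refl = inj₁ refl

Lead⇒≥ : ∀ {x y} → Lead x y → y ≤ x
Lead⇒≥ (inj₁ refl) = ≤-refl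
Lead⇒≥ (inj₂ refl) = n≤1+n _

Lead⇒≤suc : ∀ {x y} → Lead x y → x ≤ suc y
Lead⇒≤suc (inj₁ refl) = n≤1+n _
Lead⇒≤suc (inj₂ refl) = ≤-refl

-- `Lead x y` amounts to y ≤ x ≤ y + 1, and minima preserve both bounds. So cutting off at `e` keeps
-- the columns interlaced.
Lead-⊓ : ∀ {x y a b} → Lead x y → Lead a b → Lead (x ⊓ a) (y ⊓ b)
Lead-⊓ xy ab = Lead-intro (⊓-mono-≤ (Lead⇒≥ xy) (Lead⇒≥ ab)) (⊓-mono-≤ (Lead⇒≤suc xy) (Lead⇒≤suc ab))

does-true : {P : Set} (d : Dec P) → does d ≡ true → P
does-true (yes p) _ = p

does-false : {P : Set} (d : Dec P) → does d ≡ false → ¬ P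
does-false (no ¬p) _ = ¬p

module Reading {m : ℕ} (c : Vec (Fin (suc m)) (suc m))
  (c-injective : ∀ i j → lookup c i ≡ lookup c j → i ≡ j) where

  private
    n = suc m

  posC-lookup : ∀ i → posC c (toℕ (lookup c i)) ≡ toℕ i
  posC-lookup i with filter (λ k → toℕ (lookup c k) ≟ toℕ (lookup c i)) (allFin n) in eq
  ... | [] = ⊥-elim (filter-tabulate-[] (λ k → toℕ (lookup c k) ≟ toℕ (lookup c i)) id eq i refl)
  ... | k ∷ _ with filter-tabulate-head (λ k → toℕ (lookup c k) ≟ toℕ (lookup c i)) id eq
  ...   | _ , refl , hit , _ = cong toℕ (c-injective k i (Finₚ.toℕ-injective hit))

  position : Fin n → Fin n
  position j = proj₁ (injective⇒surjective (lookup c) c-injective j)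

  lookup-position : ∀ j → lookup c (position j) ≡ j
  lookup-position j = proj₂ (injective⇒surjective (lookup c) c-injective j)

  posC-toℕ : ∀ j → posC c (toℕ j) ≡ toℕ (position j)
  posC-toℕ j = trans (cong (posC c ∘ toℕ) (sym (lookup-position j))) (posC-lookup (position j))

  posC-injective : ∀ {i j} → i < n → j < n → posC c i ≡ posC c j → i ≡ j
  posC-injective {i} {j} i<n j<n eq = begin
    i              ≡⟨ Finₚ.toℕ-fromℕ< i<n ⟨
    toℕ i′         ≡⟨ cong toℕ (lookup-position i′) ⟨
    toℕ (lookup c (position i′)) ≡⟨ cong (toℕ ∘ lookup c) (Finₚ.toℕ-injective same) ⟩
    toℕ (lookup c (position j′)) ≡⟨ cong toℕ (lookup-position j′) ⟩
    toℕ j′         ≡⟨ Finₚ.toℕ-fromℕ< j<n ⟩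
    j              ∎
    where
    open ≡-Reasoning
    i′ = Fin.fromℕ< i<n
    j′ = Fin.fromℕ< j<n
    same : toℕ (position i′) ≡ toℕ (position j′)
    same = trans (sym (posC-toℕ i′)) (trans (cong (posC c) (Finₚ.toℕ-fromℕ< i<n))
      (trans eq (trans (cong (posC c) (sym (Finₚ.toℕ-fromℕ< j<n))) (posC-toℕ j′))))

  posC<n : ∀ j → posC c j < n
  posC<n j with filter (λ k → toℕ (lookup c k) ≟ j) (allFin n)
  ... | []    = s≤s z≤n
  ... | k ∷ _ = Finₚ.toℕ<n k

  up : ℕ → Bool
  up g = does (posC c g <? posC c (suc g))

  up⇒< : ∀ {g} → up g ≡ true → posC c g < posC c (suc g)
  up⇒< {g} = does-true (posC c g <? posC c (suc g))

  ¬up⇒> : ∀ {g} → suc g < n → up g ≡ false → posC c (suc g) < posC c g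
  ¬up⇒> {g} lt eq = ≤∧≢⇒< (≮⇒≥ (does-false (posC c g <? posC c (suc g)) eq))
    (λ e → 1+n≢n (posC-injective lt (<-trans ≤-refl lt) e))

  open Labels m up public

  length-filter-upTo-suc : {P : ℕ → Set} (P? : ∀ j → Dec (P j)) (k : ℕ) →
    length (filter P? (upTo (suc k))) ≡ length (filter P? (upTo k)) + ⟦ P? k ⟧
  length-filter-upTo-suc P? k = trans (cong (length ∘ filter P?) (sym (applyUpTo-∷ʳ id k)))
    (trans (cong length (filter-++ P? (upTo k) (k ∷ []))) (trans (length-++ (filter P? (upTo k)))
      (cong (length (filter P? (upTo k)) +_) singleton)))
    where
    singleton : length (filter P? (k ∷ [])) ≡ ⟦ P? k ⟧
    singleton with P? k
    ... | yes _ = refl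
    ... | no  _ = refl

  ascC≡asc : ∀ t → ascC c t ≡ asc (toℕ t)
  ascC≡asc t = go (toℕ t)
    where
    go : ∀ k → length (filter (λ j → posC c j <? posC c (suc j)) (upTo k)) ≡ asc k
    go zero = refl
    go (suc k) = trans (length-filter-upTo-suc _ k) (trans (cong (_+ ⟦ posC c k <? posC c (suc k) ⟧) (go k)) step)
      where
      step : asc k + ⟦ posC c k <? posC c (suc k) ⟧ ≡ asc (suc k)
      step with does (posC c k <? posC c (suc k))
      ... | true  = +-comm (asc k) 1
      ... | false = +-identityʳ (asc k)

  descC≡desc : ∀ t → descC c t ≡ desc (toℕ t)
  descC≡desc t = go (toℕ t) (Finₚ.toℕ<n t)
    where
    -- Below n distinct letters have distinct positions, so not ascending means descending; beyond
    -- n, `posC` only returns its default 0.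
    go : ∀ k → k < n → length (filter (λ j → posC c (suc j) <? posC c j) (upTo k)) ≡ desc k
    go zero    k<n = refl
    go (suc k) k<n = trans (length-filter-upTo-suc _ k)
      (trans (cong (_+ ⟦ posC c (suc k) <? posC c k ⟧) (go k (<-trans ≤-refl k<n))) step)
      where
      step : desc k + ⟦ posC c (suc k) <? posC c k ⟧ ≡ desc (suc k)
      step with up k in eq
      ... | true  = trans (cong (desc k +_) (⟦⟧-no (posC c (suc k) <? posC c k) (<-asym (up⇒< {k} eq)))) (+-identityʳ (desc k))
      ... | false = trans (cong (desc k +_) (⟦⟧-yes (posC c (suc k) <? posC c k) (¬up⇒> k<n eq))) (+-comm (desc k) 1)

  -- Copies of j among the first p letters of c c c ⋯: one per complete round, and one more if the
  -- current round has passed j.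
  occurrences : ℕ → ℕ → ℕ
  occurrences j p = p / n + ⟦ posC c j <? p % n ⟧

  occurrences-hit : ∀ {j p} → posC c j ≡ p % n → occurrences j p ≡ p / n
  occurrences-hit {j} {p} eq = trans (cong (p / n +_) (⟦⟧-no (posC c j <? p % n) (<-irrefl eq))) (+-identityʳ (p / n))

  occurrences-suc-hit : ∀ {j p} → posC c j ≡ p % n → occurrences j (suc p) ≡ suc (p / n)
  occurrences-suc-hit {j} {p} eq with suc-/% p n
  ... | inj₁ (q , r) = trans (cong₂ _+_ q (⟦⟧-yes (posC c j <? suc p % n) (subst (posC c j <_) (sym r) (s≤s (≤-reflexive eq)))))
                             (+-comm (p / n) 1)
  ... | inj₂ (_ , q , r) = trans (cong₂ _+_ q (⟦⟧-no (posC c j <? suc p % n) (λ lt → n≮0 (subst (posC c j <_) r lt))))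
                             (+-identityʳ (suc (p / n)))

  occurrences-suc-miss : ∀ {j p} → posC c j ≢ p % n → occurrences j (suc p) ≡ occurrences j p
  occurrences-suc-miss {j} {p} ≢r with suc-/% p n
  ... | inj₁ (q , r) = cong₂ _+_ q (⟦⟧-cong (posC c j <? suc p % n) (posC c j <? p % n)
          (λ lt → ≤∧≢⇒< (≤-pred (subst (posC c j <_) r lt)) ≢r)
          (λ lt → subst (posC c j <_) (sym r) (m<n⇒m<1+n lt)))
  ... | inj₂ (last , q , r) = trans (cong₂ _+_ q (⟦⟧-no (posC c j <? suc p % n) (λ lt → n≮0 (subst (posC c j <_) r lt))))
          (trans (+-identityʳ (suc (p / n))) (trans (+-comm 1 (p / n)) (cong (p / n +_)
            (sym (⟦⟧-yes (posC c j <? p % n) (≤∧≢⇒< (≤-pred (subst (posC c j <_) (sym last) (posC<n j))) ≢r))))))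

  posC-cinf : ∀ p → posC c (toℕ (cinf c p)) ≡ p % n
  posC-cinf p = trans (posC-lookup (p mod n)) (Finₚ.toℕ-fromℕ< (m%n<n p n))

  -- Since `e j ≤ n`, n rounds of c are enough. `M` is a variable with an equation because the
  -- product `n * n` reduces to a successor and would make `selectedFrom` unfold.
  module Target (e : ℕ → ℕ) (e-interlaced : Interlaced e) (e≤n : ∀ j → j < n → e j ≤ n)
    (M : ℕ) (M≡n*n : M ≡ n * n) where

    prefix : ℕ → List (Fin n)
    prefix p = subword c (selectedBelow c e p)

    count-prefix : ∀ p j → j < n → count j (prefix p) ≡ occurrences j p ⊓ e j
    count-prefix zero    j j<n = sym (cong (_⊓ e j) (trans (cong₂ _+_ (0/n≡0 n) (⟦⟧-no (posC c j <? 0 % n)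
      (λ lt → n≮0 (subst (posC c j <_) (m<n⇒m%n≡m {n = n} (s≤s z≤n)) lt)))) refl))
    count-prefix (suc p) j j<n with selected? c e p | toℕ (cinf c p) ≟ j
    ... | yes sel | yes refl = begin
      count j (subword c (selectedBelow c e p ∷ʳ p))   ≡⟨ cong (count j) (map-++ (cinf c) (selectedBelow c e p) (p ∷ [])) ⟩
      count j (prefix p ∷ʳ cinf c p)                   ≡⟨ count-∷ʳ-hit (prefix p) (cinf c p) ⟩
      suc (count j (prefix p))                         ≡⟨ cong suc (count-prefix p j j<n) ⟩
      suc (occurrences j p ⊓ e j)                      ≡⟨ cong (λ k → suc (k ⊓ e j)) (occurrences-hit {j} {p} (posC-cinf p)) ⟩
      suc (p / n ⊓ e j)                                ≡⟨ cong suc (m≤n⇒m⊓n≡m (<⇒≤ sel)) ⟩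
      suc (p / n)                                      ≡⟨ m≤n⇒m⊓n≡m sel ⟨
      suc (p / n) ⊓ e j                                ≡⟨ cong (_⊓ e j) (occurrences-suc-hit {j} {p} (posC-cinf p)) ⟨
      occurrences j (suc p) ⊓ e j                      ∎
      where open ≡-Reasoning
    ... | no ¬sel | yes refl = begin
      count j (prefix p)                               ≡⟨ count-prefix p j j<n ⟩
      occurrences j p ⊓ e j                            ≡⟨ cong (_⊓ e j) (occurrences-hit {j} {p} (posC-cinf p)) ⟩
      p / n ⊓ e j                                      ≡⟨ m≥n⇒m⊓n≡n (≮⇒≥ ¬sel) ⟩
      e j                                              ≡⟨ m≥n⇒m⊓n≡n (m≤n⇒m≤1+n (≮⇒≥ ¬sel)) ⟨
      suc (p / n) ⊓ e j                                ≡⟨ cong (_⊓ e j) (occurrences-suc-hit {j} {p} (posC-cinf p)) ⟨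
      occurrences j (suc p) ⊓ e j                      ∎
      where open ≡-Reasoning
    ... | yes sel | no ≢j = begin
      count j (subword c (selectedBelow c e p ∷ʳ p))   ≡⟨ cong (count j) (map-++ (cinf c) (selectedBelow c e p) (p ∷ [])) ⟩
      count j (prefix p ∷ʳ cinf c p)                   ≡⟨ count-∷ʳ-miss (prefix p) ≢j ⟩
      count j (prefix p)                               ≡⟨ count-prefix p j j<n ⟩
      occurrences j p ⊓ e j                            ≡⟨ cong (_⊓ e j) (occurrences-suc-miss {j} {p} (miss ≢j)) ⟨
      occurrences j (suc p) ⊓ e j                      ∎
      where
      open ≡-Reasoning
      miss : toℕ (cinf c p) ≢ j → posC c j ≢ p % n
      miss ≢j eq = ≢j (posC-injective (Finₚ.toℕ<n (cinf c p)) j<n (trans (posC-cinf p) (sym eq)))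
    ... | no ¬sel | no ≢j = begin
      count j (prefix p)                               ≡⟨ count-prefix p j j<n ⟩
      occurrences j p ⊓ e j                            ≡⟨ cong (_⊓ e j) (occurrences-suc-miss {j} {p} (miss ≢j)) ⟨
      occurrences j (suc p) ⊓ e j                      ∎
      where
      open ≡-Reasoning
      miss : toℕ (cinf c p) ≢ j → posC c j ≢ p % n
      miss ≢j eq = ≢j (posC-injective (Finₚ.toℕ<n (cinf c p)) j<n (trans (posC-cinf p) (sym eq)))

    occurrences-lead : ∀ {i j} p → posC c i < posC c j → Lead (occurrences i p) (occurrences j p)
    occurrences-lead {i} {j} p lt = Lead-intro
      (+-monoʳ-≤ (p / n) (⟦⟧-mono (posC c j <? p % n) (posC c i <? p % n) (<-trans lt)))
      (≤-trans (+-monoʳ-≤ (p / n) (⟦⟧≤1 (posC c i <? p % n)))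
        (≤-trans (≤-reflexive (+-comm (p / n) 1)) (s≤s (m≤m+n (p / n) _))))

    prefix-interlaced : ∀ p → Interlaced (λ j → count j (prefix p))
    prefix-interlaced p g lt =
      (λ u → subst₂ Lead (sym (count-prefix p g g<n)) (sym (count-prefix p (suc g) lt))
               (Lead-⊓ (occurrences-lead {g} {suc g} p (up⇒< {g} u)) (proj₁ (e-interlaced g lt) u))) ,
      (λ d → subst₂ Lead (sym (count-prefix p (suc g) lt)) (sym (count-prefix p g g<n))
               (Lead-⊓ (occurrences-lead {suc g} {g} p (¬up⇒> lt d)) (proj₂ (e-interlaced g lt) d)))
      where
      g<n : g < n
      g<n = <-trans ≤-refl lt

    prefix-legal : ∀ p → Legal (prefix p)
    prefix-legal zero = []
    prefix-legal (suc p) with selected? c e p | prefix-interlaced (suc p)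
    ... | no  _ | _     = prefix-legal p
    ... | yes _ | after = subst Legal (sym unfold)
          (snoc (prefix-legal p) (cinf c p) (subst (λ w → Interlaced (λ j → count j w)) unfold after))
      where
      unfold : subword c (selectedBelow c e p ∷ʳ p) ≡ prefix p ∷ʳ cinf c p
      unfold = map-++ (cinf c) (selectedBelow c e p) (p ∷ [])

    longest : List ℕ
    longest = selectedFrom c e 0 M

    prefix≡longest : prefix M ≡ subword c longest
    prefix≡longest = cong (subword c) (sym (selectedBelow-++ c e 0 M))

    longest-legal : Legal (subword c longest)
    longest-legal = subst Legal prefix≡longest (prefix-legal M)

    count-longest : ∀ j → j < n → count j (subword c longest) ≡ e j
    count-longest j j<n = begin
      count j (subword c longest)   ≡⟨ cong (count j) prefix≡longest ⟨
      count j (prefix M)      ≡⟨ count-prefix M j j<n ⟩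
      occurrences j M ⊓ e j         ≡⟨ cong (λ p → occurrences j p ⊓ e j) M≡n*n ⟩
      occurrences j (n * n) ⊓ e j   ≡⟨ cong (_⊓ e j) (cong₂ _+_ (m*n/n≡m n n) (⟦⟧-no (posC c j <? n * n % n)
                                         (λ lt → n≮0 (subst (posC c j <_) (m*n%n≡0 n n) lt)))) ⟩
      (n + 0) ⊓ e j                 ≡⟨ cong (_⊓ e j) (+-identityʳ n) ⟩
      n ⊓ e j                       ≡⟨ m≥n⇒m⊓n≡n (e≤n j j<n) ⟩
      e j                           ∎
      where open ≡-Reasoning

-- The rotation Θ

length-filter-tabulate-∘ : {X Y : Set} {P : Y → Set} (P? : Decidable P) (f : X → Y) {n : ℕ} (g : Fin n → X) →
  length (filter P? (tabulate (f ∘ g))) ≡ length (filter (P? ∘ f) (tabulate g))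
length-filter-tabulate-∘ P? f {zero}  g = refl
length-filter-tabulate-∘ P? f {suc n} g with P? (f (g zero))
... | yes _ = cong suc (length-filter-tabulate-∘ P? f (g ∘ suc))
... | no  _ = length-filter-tabulate-∘ P? f (g ∘ suc)

rotBy-suc : ∀ k d → rotBy (suc k) d ≡ rot (rotBy k d)
rotBy-suc k (a , b) = cong₂ _,_ (shift a) (shift b)
  where
  shift : ∀ x → x ℤ.+ ℤ.+ suc k ≡ x ℤ.+ ℤ.+ k ℤ.+ ℤ.+ 1
  shift x = trans (cong (λ j → x ℤ.+ ℤ.+ j) (+-comm 1 k)) (sym (ℤₚ.+-assoc x (ℤ.+ k) (ℤ.+ 1)))

rotBy-0 : ∀ d → rotBy 0 d ≡ d
rotBy-0 (a , b) = cong₂ _,_ (ℤₚ.+-identityʳ a) (ℤₚ.+-identityʳ b)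

module _ {n : ℕ} (Q : List (Fin n)) where

  private
    _!_ = List.lookup

  occ-next : ∀ q j → toℕ q < toℕ j → Q ! j ≡ Q ! q →
    (∀ i → toℕ i < toℕ j → ¬ (toℕ q < toℕ i × Q ! i ≡ Q ! q)) → occ Q j ≡ suc (occ Q q)
  occ-next q j q<j Qj≡Qq none = length-filter-tabulate-insert
    (λ i → (toℕ i <? toℕ j) ×-dec (Q ! i Fin.≟ Q ! j)) (λ i → (toℕ i <? toℕ q) ×-dec (Q ! i Fin.≟ Q ! q)) id q
    (q<j , sym Qj≡Qq) (λ (q<q , _) → <-irrefl refl q<q)
    λ i i≢q → (λ (i<j , Qi) → ≤∧≢⇒< (≮⇒≥ (λ q<i → none i i<j (q<i , trans Qi Qj≡Qq))) (i≢q ∘ Finₚ.toℕ-injective) , trans Qi Qj≡Qq) ,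
              (λ (i<q , Qi) → <-trans i<q q<j , trans Qi (sym Qj≡Qq))

  occ-last : ∀ q → (∀ i → ¬ (toℕ q < toℕ i × Q ! i ≡ Q ! q)) → count (toℕ (Q ! q)) Q ≡ suc (occ Q q)
  occ-last q none = trans (cong (count (toℕ (Q ! q))) (sym (tabulate-lookup Q)))
    (trans (length-filter-tabulate-∘ (λ x → toℕ x ≟ toℕ (Q ! q)) (Q !_) id)
      (length-filter-tabulate-insert (λ i → toℕ (Q ! i) ≟ toℕ (Q ! q)) (λ i → (toℕ i <? toℕ q) ×-dec (Q ! i Fin.≟ Q ! q)) id q
        refl (λ (q<q , _) → <-irrefl refl q<q)
        λ i i≢q → (λ Qi → ≤∧≢⇒< (≮⇒≥ (λ q<i → none i (q<i , Finₚ.toℕ-injective Qi))) (i≢q ∘ Finₚ.toℕ-injective) , Finₚ.toℕ-injective Qi) ,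
                  (λ (_ , Qi) → cong toℕ Qi)))

  occ-first : ∀ q → (∀ i → toℕ i < toℕ q → Q ! i ≢ Q ! q) → occ Q q ≡ 0
  occ-first q none = cong length (filter-tabulate-none
    (λ i → (toℕ i <? toℕ q) ×-dec (Q ! i Fin.≟ Q ! q)) id (λ i (i<q , Qi) → none i i<q Qi))

  count≡0 : ∀ s → (∀ i → Q ! i ≢ s) → count (toℕ s) Q ≡ 0
  count≡0 s none = trans (cong (count (toℕ s)) (sym (tabulate-lookup Q)))
    (cong length (filter-tabulate-none (λ x → toℕ x ≟ toℕ s) (Q !_) (λ i Qi → none i (Finₚ.toℕ-injective Qi))))

  module _ {G : Set} (ev : List (Fin n) → G) (_≟G_ : DecidableEquality G) (w₀ : List (Fin n)) where
    open Coxeter ev _≟G_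

    -- The two clauses of Θ in terms of occurrence numbers; the hypothesis on ψ excludes the default
    -- value.
    Θ-spec : ∀ q → 0 < count (toℕ (ψ w₀ (Q ! q))) Q →
      (Q ! Θ w₀ Q q ≡ Q ! q × occ Q (Θ w₀ Q q) ≡ suc (occ Q q)) ⊎
      (count (toℕ (Q ! q)) Q ≡ suc (occ Q q) × Q ! Θ w₀ Q q ≡ ψ w₀ (Q ! q) × occ Q (Θ w₀ Q q) ≡ 0)
    Θ-spec q present
      with filter (λ j → (toℕ q <? toℕ j) ×-dec (Q ! j Fin.≟ Q ! q)) (allFin (length Q)) in later
    ... | j ∷ _ with filter-tabulate-head (λ j → (toℕ q <? toℕ j) ×-dec (Q ! j Fin.≟ Q ! q)) id later
    ...   | _ , refl , (q<j , Qj) , before = inj₁ (Qj , occ-next q j q<j Qj before)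
    Θ-spec q present | []
      with filter (λ j → Q ! j Fin.≟ ψ w₀ (Q ! q)) (allFin (length Q)) in first
    ... | [] = ⊥-elim (<-irrefl (sym (count≡0 (ψ w₀ (Q ! q))
                 (filter-tabulate-[] (λ j → Q ! j Fin.≟ ψ w₀ (Q ! q)) id first))) present)
    ... | j ∷ _ with filter-tabulate-head (λ j → Q ! j Fin.≟ ψ w₀ (Q ! q)) id first
    ...   | _ , refl , Qj , before = inj₂
            (occ-last q (filter-tabulate-[] (λ j → (toℕ q <? toℕ j) ×-dec (Q ! j Fin.≟ Q ! q)) id later) ,
             Qj , occ-first j (λ i i<j Qi → before i i<j (trans Qi Qj)))

    -- Along the copies of one letter, rotation is built into φ. The only real case is the jump from
    -- the last copy of s to the first copy of ψ(s), which the last hypothesis covers.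
    rotates : (Same : Diag → Diag → Set) → (∀ {d d′} → d ≡ d′ → Same d d′) → (base : Fin n → Diag) →
      (∀ s → 0 < count (toℕ s) Q) →
      (∀ s → Same (base (ψ w₀ s)) (rotBy (count (toℕ s) Q) (base s))) →
      ∀ q → Same (rotBy (occ Q (Θ w₀ Q q)) (base (Q ! Θ w₀ Q q))) (rot (rotBy (occ Q q) (base (Q ! q))))
    rotates Same same-refl base present wrap q with Θ-spec q (present (ψ w₀ (Q ! q)))
    ... | inj₁ (letter , o) = same-refl (trans (cong₂ (λ k s → rotBy k (base s)) o letter)
                                (rotBy-suc (occ Q q) (base (Q ! q))))
    ... | inj₂ (total , letter , o) = subst₂ Same
      (sym (trans (cong₂ (λ k s → rotBy k (base s)) o letter) (rotBy-0 (base (ψ w₀ (Q ! q))))))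
      (trans (cong (λ k → rotBy k (base (Q ! q))) total) (rotBy-suc (occ Q q) (base (Q ! q))))
      (wrap (Q ! q))

-- The automorphism ψ and the letter counts of Q

module _ {n : ℕ} {G : Set} (ev : List (Fin n) → G) (_≟G_ : DecidableEquality G) where
  open Coxeter ev _≟G_

  ψ-unique : ∀ w₀ s t → ev (reverse w₀ ++ s ∷ w₀) ≡ ev (t ∷ []) → (∀ u → ev (t ∷ []) ≡ ev (u ∷ []) → t ≡ u) → ψ w₀ s ≡ t
  ψ-unique w₀ s t eq inj with filter (λ u → ev (reverse w₀ ++ s ∷ w₀) ≟G ev (u ∷ [])) (allFin n) in found
  ... | [] = ⊥-elim (filter-tabulate-[] (λ u → ev (reverse w₀ ++ s ∷ w₀) ≟G ev (u ∷ [])) id found t eq)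
  ... | u ∷ _ with filter-tabulate-head (λ u → ev (reverse w₀ ++ s ∷ w₀) ≟G ev (u ∷ [])) id found
  ...   | _ , refl , hit , _ = sym (inj u (trans (sym eq) hit))

σ-left : ∀ {n} (t : Fin n) → σ t (inject₁ t) ≡ suc t
σ-left zero    = refl
σ-left (suc t) = cong suc (σ-left t)

σ-right : ∀ {n} (t : Fin n) → σ t (suc t) ≡ inject₁ t
σ-right zero    = refl
σ-right (suc t) = cong suc (σ-right t)

-- Among adjacent transpositions only `σ t` sends `inject₁ t` to `suc t`.
σ-injective : ∀ {n} (t u : Fin n) → (∀ i → σ t i ≡ σ u i) → t ≡ u
σ-injective t u eq = go (σ-view u (inject₁ t)) refl (trans (sym (eq (inject₁ t))) (σ-left t))
  where
  go : ∀ {i j} → σ-View u i j → i ≡ inject₁ t → j ≡ suc t → t ≡ u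
  go left p q = sym (Finₚ.suc-injective q)
  go right p q = ⊥-elim (m≢1+m+n (toℕ u) {1} (begin
      toℕ u                 ≡⟨ Finₚ.toℕ-inject₁ u ⟨
      toℕ (inject₁ u)       ≡⟨ cong toℕ q ⟩
      suc (toℕ t)           ≡⟨ cong suc (trans (cong toℕ p) (Finₚ.toℕ-inject₁ t)) ⟨
      suc (suc (toℕ u))     ≡⟨ cong suc (+-comm 1 (toℕ u)) ⟩
      suc (toℕ u + 1)       ∎))
    where open ≡-Reasoning
  go (fixed _ _) refl q = ⊥-elim (Finₚ.<⇒≢ (Finₚ.≤̄⇒inject₁< {i = t} {j = t} ≤-refl) q)

opposite-inject₁ : ∀ {n} (t : Fin n) → opposite (inject₁ t) ≡ suc (opposite t)
opposite-inject₁ zero    = refl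
opposite-inject₁ (suc t) = cong inject₁ (opposite-inject₁ t)

-- Reversal carries the two positions moved by `σ t` to those moved by `σ (opposite t)`, with left
-- and right exchanged.
σ-opposite : ∀ {n} (t : Fin n) i → σ (opposite t) (opposite i) ≡ opposite (σ t i)
σ-opposite t i = go (σ-view t i)
  where
  go : ∀ {i j} → σ-View t i j → σ (opposite t) (opposite i) ≡ opposite j
  go left  = trans (cong (σ (opposite t)) (opposite-inject₁ t)) (σ-right (opposite t))
  go right = trans (σ-left (opposite t)) (sym (opposite-inject₁ t))
  go (fixed {i} ≢t ≢1+t) = stays (σ-view (opposite t) (opposite i)) refl
    where
    stays : ∀ {j k} → σ-View (opposite t) j k → j ≡ opposite i → k ≡ opposite i
    stays left eq = ⊥-elim (≢1+t (cong toℕ (trans (sym (Finₚ.opposite-involutive i))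
      (trans (cong opposite (sym eq)) (trans (opposite-inject₁ (opposite t)) (cong suc (Finₚ.opposite-involutive t)))))))
    stays right eq = ⊥-elim (≢t (trans (cong toℕ (trans (sym (Finₚ.opposite-involutive i))
      (trans (cong opposite (sym eq)) (cong inject₁ (Finₚ.opposite-involutive t))))) (Finₚ.toℕ-inject₁ t)))
    stays (fixed _ _) eq = eq

count-replicate : ∀ {n} (s : Fin n) k (xs : List (Fin n)) → count (toℕ s) xs ≡ 1 → count (toℕ s) (concat (replicate k xs)) ≡ k
count-replicate s zero    xs one = refl
count-replicate s (suc k) xs one = trans (count-++ (toℕ s) xs (concat (replicate k xs)))
  (cong₂ _+_ one (count-replicate s k xs one))

toList≡tabulate : {X : Set} {n : ℕ} (v : Vec X n) → Vec.toList v ≡ tabulate (lookup v)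
toList≡tabulate []       = refl
toList≡tabulate (x ∷ xs) = cong (x ∷_) (toList≡tabulate xs)

module Counting {m : ℕ} (c : Vec (Fin (suc m)) (suc m))
  (c-injective : ∀ i j → lookup c i ≡ lookup c j → i ≡ j) where
  open Reading c c-injective

  private
    none? : Fin (suc m) → Dec ⊥
    none? _ = no id

  count-c : ∀ s → count (toℕ s) (Vec.toList c) ≡ 1
  count-c s = trans (cong (count (toℕ s)) (toList≡tabulate c)) (trans
    (length-filter-tabulate-insert (λ x → toℕ x ≟ toℕ s) none? (lookup c) (position s)
      (cong toℕ (lookup-position s)) id
      λ i i≢p → (λ eq → i≢p (c-injective i (position s) (trans (Finₚ.toℕ-injective eq) (sym (lookup-position s))))) , ⊥-elim)
    (cong (suc ∘ length) (filter-tabulate-none none? (lookup c) (λ _ → id))))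

  count-Q : ∀ k ps s → count (toℕ s) (mkQ k c ps) ≡ k + count (toℕ s) (subword c ps)
  count-Q k ps s = trans (count-++ (toℕ s) (concat (replicate k (Vec.toList c))) (subword c ps))
    (cong (_+ count (toℕ s) (subword c ps)) (count-replicate s k (Vec.toList c) (count-c s)))

-- Type A

Separated : ∀ {n} → Fin n → GA n → Set
Separated i v = ∀ a b → toℕ a ≤ toℕ i → toℕ i < toℕ b → toℕ (lookup v b) < toℕ (lookup v a)

σ-≤ : ∀ {n} {i j : Fin n} → toℕ j ≢ toℕ i → ∀ a → toℕ a ≤ toℕ i → toℕ (σ j a) ≤ toℕ i
σ-≤ {i = i} {j} j≢i a = go (σ-view j a)
  where
  go : ∀ {a b} → σ-View j a b → toℕ a ≤ toℕ i → toℕ b ≤ toℕ i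
  go left        le = ≤∧≢⇒< (subst (_≤ toℕ i) (Finₚ.toℕ-inject₁ j) le) j≢i
  go right       le = subst (_≤ toℕ i) (sym (Finₚ.toℕ-inject₁ j)) (<⇒≤ le)
  go (fixed _ _) le = le

σ-> : ∀ {n} {i j : Fin n} → toℕ j ≢ toℕ i → ∀ a → toℕ i < toℕ a → toℕ i < toℕ (σ j a)
σ-> {i = i} {j} j≢i a = go (σ-view j a)
  where
  go : ∀ {a b} → σ-View j a b → toℕ i < toℕ a → toℕ i < toℕ b
  go left        lt = m<n⇒m<1+n (subst (toℕ i <_) (Finₚ.toℕ-inject₁ j) lt)
  go right       lt = subst (toℕ i <_) (sym (Finₚ.toℕ-inject₁ j)) (≤∧≢⇒< (≤-pred lt) (j≢i ∘ sym))
  go (fixed _ _) lt = lt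

lookup-actA : ∀ {n} (v : GA n) t i → lookup (actA v t) i ≡ lookup v (σ t i)
lookup-actA v t i = trans (cong (λ w → lookup w i) (swapVec≡swapAdj v t)) (lookup-swapAdj v t i)

separated-act : ∀ {n} {i j : Fin n} (v : GA n) → toℕ j ≢ toℕ i → Separated i (actA v j) → Separated i v
separated-act {i = i} {j} v j≢i sep a b a≤i i<b =
  subst₂ (λ x y → toℕ x < toℕ y) (undo b) (undo a) (sep (σ j a) (σ j b) (σ-≤ {i = i} j≢i a a≤i) (σ-> {i = i} j≢i b i<b))
  where
  undo : ∀ a → lookup (actA v j) (σ j a) ≡ lookup v a
  undo a = trans (lookup-actA v j (σ j a)) (cong (lookup v) (σ-involutive j a))

-- Letters other than s_i permute the positions on each side of the cut after i, so separation at
-- the end was already there at the start.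
separated-foldl : ∀ {n} (i : Fin n) (v : GA n) xs → count (toℕ i) xs ≡ 0 →
  Separated i (foldl actA v xs) → Separated i v
separated-foldl i v []       none sep = sep
separated-foldl i v (x ∷ xs) none sep with toℕ x ≟ toℕ i
... | yes x≡i with refl ← Finₚ.toℕ-injective x≡i = ⊥-elim (1+n≢0 (trans (sym (count-hit x xs)) none))
... | no  x≢i = separated-act v x≢i (separated-foldl i (actA v x) xs (trans (sym (count-miss xs x≢i)) none) sep)

separated⇒descent : ∀ {n} (i : Fin n) (v : GA n) → Separated i v → StatA.stat (actA v i) < StatA.stat v
separated⇒descent i v sep = ≤-reflexive (begin
  suc (StatA.stat (actA v i))   ≡⟨ +-comm 1 (StatA.stat (actA v i)) ⟩
  StatA.stat (actA v i) + 1     ≡⟨ cong (StatA.stat (actA v i) +_) (⟦⟧-yes (toℕ (lookup v (suc i)) <? toℕ (lookup v (inject₁ i))) inverted) ⟨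
  StatA.stat (actA v i) + inversionA (lookup v (inject₁ i)) (lookup v (suc i))  ≡⟨ statA-act v i ⟩
  StatA.stat v + inversionA (lookup v (suc i)) (lookup v (inject₁ i))
    ≡⟨ cong (StatA.stat v +_) (⟦⟧-no (toℕ (lookup v (inject₁ i)) <? toℕ (lookup v (suc i))) (<-asym inverted)) ⟩
  StatA.stat v + 0              ≡⟨ +-identityʳ (StatA.stat v) ⟩
  StatA.stat v                  ∎)
  where
  open ≡-Reasoning
  inverted : toℕ (lookup v (suc i)) < toℕ (lookup v (inject₁ i))
  inverted = sep (inject₁ i) (suc i) (≤-reflexive (Finₚ.toℕ-inject₁ i)) ≤-refl

opposite-anti : ∀ {n} (i j : Fin n) → toℕ i < toℕ j → toℕ (opposite j) < toℕ (opposite i)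
opposite-anti {n} i j i<j = subst₂ _<_ (sym (Finₚ.opposite-prop j)) (sym (Finₚ.opposite-prop i))
  (∸-monoʳ-< (s≤s i<j) (Finₚ.toℕ<n j))

Σ<-suc : ∀ n → Σ< n suc ≡ total 0 1 (suc n)
Σ<-suc zero    = refl
Σ<-suc (suc n) = trans (cong (_+ suc n) (Σ<-suc n))
  (trans (+-comm (total 0 1 (suc n)) (suc n)) (cong (_+ total 0 1 (suc n)) (sym (*-identityʳ (suc n)))))

neg-+-cancel : ∀ x y → ℤ.- (ℤ.+ x) ℤ.+ ℤ.+ (x + y) ≡ ℤ.+ y
neg-+-cancel x y = trans (sym (ℤₚ.+-assoc (ℤ.- (ℤ.+ x)) (ℤ.+ x) (ℤ.+ y)))
  (trans (cong (ℤ._+ ℤ.+ y) (ℤₚ.+-inverseˡ (ℤ.+ x))) (ℤₚ.+-identityˡ (ℤ.+ y)))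

∣neg-minus∣ : ∀ x y → ℤ.∣ ℤ.- (ℤ.+ x) ℤ.- ℤ.+ y ∣ ≡ x + y
∣neg-minus∣ x y = trans (cong ℤ.∣_∣ (sym (ℤₚ.neg-distrib-+ (ℤ.+ x) (ℤ.+ y)))) (ℤₚ.∣-i∣≡∣i∣ (ℤ.+ (x + y)))

≡⇒≡[mod] : ∀ {m x y} → x ≡ y → x ≡[mod m ] y
≡⇒≡[mod] {m} {x} refl = subst (λ z → m ∣ℕ ℤ.∣ z ∣) (sym (ℤₚ.+-inverseʳ x)) (m ∣0)

≡⇒SameDiag : ∀ {m d d′} → d ≡ d′ → SameDiag m d d′
≡⇒SameDiag {m} {d} refl = inj₁ (≡⇒≡[mod] {m} {proj₁ d} refl , ≡⇒≡[mod] {m} {proj₂ d} refl)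

module TypeA {m : ℕ} (c : Vec (Fin (suc m)) (suc m))
  (c-injective : ∀ i j → lookup c i ≡ lookup c j → i ≡ j)
  (M : ℕ) (M≡n*n : M ≡ suc m * suc m) where
  open Reading c c-injective
  open Target targetA targetA-interlaced (λ _ → targetA≤n) M M≡n*n
  open LongestWord m up
  open Counting c c-injective
  open Length (lengthA (suc m))

  private
    n = suc m
    w₀ = subword c longest

  reverses : ∀ (v : GA n) i → lookup (foldl actA v w₀) i ≡ lookup v (opposite i)
  reverses = foldl-actA-reverses longest-legal count-longest

  lookup-w₀ : ∀ i → lookup (evA w₀) i ≡ opposite i
  lookup-w₀ i = trans (reverses (Vec.allFin (suc n)) i) (lookup∘tabulate id (opposite i))

  -- Reversing the summation turns asc (m - j) into asc j, and asc j + desc j = j.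
  length-longest : length longest ≡ total 0 1 (suc n)
  length-longest = begin
    length longest                                              ≡⟨ length-map (cinf c) longest ⟨
    length w₀                                                   ≡⟨ length≡Σcount w₀ ⟩
    Σ< n (λ j → count j w₀)                                     ≡⟨ Σ<-cong n count-longest ⟩
    Σ< n (λ j → suc (desc j) + asc (m ∸ j))                     ≡⟨ Σ<-+ n (suc ∘ desc) (λ j → asc (m ∸ j)) ⟩
    Σ< n (suc ∘ desc) + Σ< n (λ j → asc (m ∸ j))                ≡⟨ cong (Σ< n (suc ∘ desc) +_) (Σ<-reverse m asc) ⟩
    Σ< n (suc ∘ desc) + Σ< n asc                                ≡⟨ Σ<-+ n (suc ∘ desc) asc ⟨
    Σ< n (λ j → suc (desc j) + asc j)                           ≡⟨ Σ<-cong n (λ j _ → cong suc (trans (+-comm (desc j) (asc j)) (asc+desc j))) ⟩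
    Σ< n suc                                                    ≡⟨ Σ<-suc n ⟩
    total 0 1 (suc n)                                           ∎
    where open ≡-Reasoning

  ℓ-max : ∀ g → ℓ g ≤ length longest
  ℓ-max g = ≤-trans (StatA.stat≤total {S = 0} g (λ _ → z≤n) (λ i j _ → ⟦⟧≤1 (toℕ (lookup g j) <? toℕ (lookup g i))))
    (≤-reflexive (sym length-longest))

  ℓ-longest : length longest ≤ ℓ (evA w₀)
  ℓ-longest = ≤-trans (≤-reflexive length-longest) (StatA.total≤stat {S = 0} (evA w₀) (λ _ → z≤n)
    λ i j i<j → ≤-reflexive (sym (⟦⟧-yes (toℕ (lookup (evA w₀) j) <? toℕ (lookup (evA w₀) i))
      (subst₂ (λ x y → toℕ x < toℕ y) (sym (lookup-w₀ j)) (sym (lookup-w₀ i)) (opposite-anti i j i<j)))))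

  skip : ∀ pre p r → p < M → pre ++ selectedFrom c targetA p r ≡ longest → ¬ Selected c targetA p →
    ℓ (actA (evA (subword c pre)) (cinf c p)) < ℓ (evA (subword c pre))
  skip pre p r _ eq ¬sel = separated⇒descent (cinf c p) (evA (subword c pre))
    (separated-foldl (cinf c p) (evA (subword c pre)) rest
      (count-exhausted c targetA (toℕ (cinf c p)) p r (≮⇒≥ ¬sel))
      (subst (Separated (cinf c p)) split separated-w₀))
    where
    rest : List (Fin n)
    rest = subword c (selectedFrom c targetA p r)
    split : evA w₀ ≡ foldl actA (evA (subword c pre)) rest
    split = trans (cong (evA ∘ subword c) (sym eq)) (trans (cong evA (map-++ (cinf c) pre _))
      (foldl-++ actA (Vec.allFin (suc n)) (subword c pre) rest))
    separated-w₀ : Separated (cinf c p) (evA w₀)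
    separated-w₀ a b a≤i i<b = subst₂ (λ x y → toℕ x < toℕ y) (sym (lookup-w₀ b)) (sym (lookup-w₀ a))
      (opposite-anti a b (≤-<-trans a≤i i<b))

  open Greedy decGA c targetA M ℓ-max ℓ-longest skip using (lex-first) public

  evA-injective : ∀ t u → evA (t ∷ []) ≡ evA (u ∷ []) → t ≡ u
  evA-injective t u eq = σ-injective t u λ i → trans (sym (at t i)) (trans (cong (λ w → lookup w i) eq) (at u i))
    where
    at : ∀ t i → lookup (actA (Vec.allFin (suc n)) t) i ≡ σ t i
    at t i = trans (lookup-actA (Vec.allFin (suc n)) t i) (lookup∘tabulate id (σ t i))

  -- With v = w∘⁻¹, `reverses` lets w∘ pass s at the price of turning it into `opposite s`; then v
  -- w∘ cancels.
  ψ-opposite : ∀ s → Coxeter.ψ evA decGA w₀ s ≡ opposite s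
  ψ-opposite s = ψ-unique evA decGA w₀ s (opposite s)
    (trans (foldl-++ actA (Vec.allFin (suc n)) (reverse w₀) (s ∷ w₀)) (lookup-ext λ i → begin
      lookup (foldl actA (actA v s) w₀) i             ≡⟨ reverses (actA v s) i ⟩
      lookup (actA v s) (opposite i)                  ≡⟨ lookup-actA v s (opposite i) ⟩
      lookup v (σ s (opposite i))                     ≡⟨ cong (λ t → lookup v (σ t (opposite i))) (Finₚ.opposite-involutive s) ⟨
      lookup v (σ (opposite (opposite s)) (opposite i)) ≡⟨ cong (lookup v) (σ-opposite (opposite s) i) ⟩
      lookup v (opposite (σ (opposite s) i))          ≡⟨ reverses v (σ (opposite s) i) ⟨
      lookup (foldl actA v w₀) (σ (opposite s) i)     ≡⟨ cong (λ w → lookup w (σ (opposite s) i)) (foldl-reverse (Vec.allFin (suc n)) w₀) ⟩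
      lookup (Vec.allFin (suc n)) (σ (opposite s) i)  ≡⟨ lookup-actA (Vec.allFin (suc n)) (opposite s) i ⟨
      lookup (actA (Vec.allFin (suc n)) (opposite s)) i ∎))
    (evA-injective (opposite s))
    where
    open ≡-Reasoning
    v : GA n
    v = evA (reverse w₀)

  -- The equation for `ps` is an argument because the type of `q` depends on `ps`; matching on it
  -- replaces both at once.
  rotation-longest : ∀ k → 1 ≤ k → ∀ ps → ps ≡ longest → (q : Fin (length (mkQ k c ps))) →
    SameDiag (suc (n + 2 * k))
      (φA k c (mkQ k c ps) (Coxeter.Θ evA decGA (subword c ps) (mkQ k c ps) q))
      (rot (φA k c (mkQ k c ps) q))
  rotation-longest k 1≤k _ refl = rotates (mkQ k c longest) evA decGA w₀ (SameDiag N) ≡⇒SameDiag base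
    (λ s → ≤-trans 1≤k (≤-trans (m≤m+n k _) (≤-reflexive (sym (count-Q k longest s)))))
    wrap
    where
    N = suc (n + 2 * k)
    base : Fin n → Diag
    base t = ℤ.+ ascC c t , ℤ.- (ℤ.+ (suc k + descC c t))
    wrap : ∀ s → SameDiag N (base (Coxeter.ψ evA decGA w₀ s)) (rotBy (count (toℕ s) (mkQ k c longest)) (base s))
    wrap s = subst₂ (SameDiag N) (sym start) (sym end)
      -- The endpoints change roles: b_i arrives exactly at a_{ψ(i)}, while a_i meets b_{ψ(i)} after
      -- closing the full circle of N vertices.
      (inj₂ (≡⇒≡[mod] {N} (sym (trans (cong (λ z → ℤ.- (ℤ.+ (suc k + D)) ℤ.+ ℤ.+ z) shift) (neg-+-cancel (suc k + D) A′))) ,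
             subst (N ∣ℕ_) (sym (trans (∣neg-minus∣ (suc k + D′) (A + (k + targetA j))) total-turn)) ∣-refl))
      where
      j = toℕ s
      A = asc j
      D = desc j
      A′ = asc (m ∸ j)
      D′ = desc (m ∸ j)
      base≡ : ∀ t → base t ≡ (ℤ.+ asc (toℕ t) , ℤ.- (ℤ.+ (suc k + desc (toℕ t))))
      base≡ t = cong₂ (λ a d → ℤ.+ a , ℤ.- (ℤ.+ (suc k + d))) (ascC≡asc t) (descC≡desc t)
      start : base (Coxeter.ψ evA decGA w₀ s) ≡ (ℤ.+ A′ , ℤ.- (ℤ.+ (suc k + D′)))
      start = trans (cong base (ψ-opposite s)) (trans (base≡ (opposite s))
        (cong (λ i → ℤ.+ asc i , ℤ.- (ℤ.+ (suc k + desc i))) (Finₚ.opposite-prop s)))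
      end : rotBy (count (toℕ s) (mkQ k c longest)) (base s) ≡
            rotBy (k + targetA j) (ℤ.+ A , ℤ.- (ℤ.+ (suc k + D)))
      end = cong₂ rotBy (trans (count-Q k longest s) (cong (k +_) (count-longest j (Finₚ.toℕ<n s)))) (base≡ s)
      shift : k + targetA j ≡ suc k + D + A′
      shift = trans (+-suc k (D + A′)) (cong suc (sym (+-assoc k D A′)))
      total-turn : suc k + D′ + (A + (k + targetA j)) ≡ N
      total-turn = begin
        suc k + D′ + (A + (k + suc (D + A′)))
          ≡⟨ solve 5 (λ k A D A′ D′ → con 1 :+ k :+ D′ :+ (A :+ (k :+ (con 1 :+ (D :+ A′)))) :=
                con 2 :+ ((A :+ D) :+ (A′ :+ D′)) :+ con 2 :* k) refl k A D A′ D′ ⟩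
        2 + ((A + D) + (A′ + D′)) + 2 * k
          ≡⟨ cong (λ z → 2 + z + 2 * k) (trans (cong₂ _+_ (asc+desc j) (asc+desc (m ∸ j))) (m+[n∸m]≡n (≤-pred (Finₚ.toℕ<n s)))) ⟩
        2 + m + 2 * k ∎
        where open ≡-Reasoning
              open +-*-Solver

  rotation : ∀ k → 1 ≤ k → ∀ ps → Coxeter.IsWoC evA decGA c ps → (q : Fin (length (mkQ k c ps))) →
    SameDiag (suc (n + 2 * k))
      (φA k c (mkQ k c ps) (Coxeter.Θ evA decGA (subword c ps) (mkQ k c ps) q))
      (rot (φA k c (mkQ k c ps) q))
  rotation k 1≤k ps isWoC = rotation-longest k 1≤k ps (lex-first ps isWoC)

-- Type B

module TypeB {m : ℕ} (c : Vec (Fin (suc m)) (suc m))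
  (c-injective : ∀ i j → lookup c i ≡ lookup c j → i ≡ j)
  (M : ℕ) (M≡n*n : M ≡ suc m * suc m) where
  open Reading c c-injective

  private
    n = suc m

    targetB : ℕ → ℕ
    targetB _ = n

  open Target targetB (λ _ _ → (λ _ → inj₁ refl) , (λ _ → inj₁ refl)) (λ _ _ → ≤-refl) M M≡n*n
  open LongestWord m up
  open Counting c c-injective
  open Length (lengthB m)

  private
    w₀ = subword c longest
    ε : GB n
    ε = Vec.tabulate (λ j → (false , j))

  negates : ∀ (v : GB n) → foldl actB v w₀ ≡ Vec.map neg v
  negates v = lookup-ext λ i → trans (foldl-actB-negates longest-legal count-longest v i) (sym (lookup-map i neg v))

  lookup-w₀ : ∀ i → lookup (evB w₀) i ≡ (true , i)
  lookup-w₀ i = trans (cong (λ w → lookup w i) (negates ε))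
    (trans (lookup-map i neg ε) (cong neg (lookup∘tabulate (false ,_) i)))

  total-square : ∀ k → total 1 2 k ≡ k * k
  total-square zero    = refl
  total-square (suc k) = trans (cong (1 + k * 2 +_) (total-square k))
    (solve 1 (λ k → con 1 :+ k :* con 2 :+ k :* k := (con 1 :+ k) :* (con 1 :+ k)) refl k)
    where open +-*-Solver

  length-longest : length longest ≡ total 1 2 n
  length-longest = begin
    length longest             ≡⟨ length-map (cinf c) longest ⟨
    length w₀                  ≡⟨ length≡Σcount w₀ ⟩
    Σ< n (λ j → count j w₀)    ≡⟨ Σ<-cong n count-longest ⟩
    Σ< n (λ _ → n)             ≡⟨ Σ<-const n n ⟩
    n * n                      ≡⟨ total-square n ⟨
    total 1 2 n                ∎
    where open ≡-Reasoning

  ℓ-max : ∀ g → ℓ g ≤ length longest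
  ℓ-max g = ≤-trans (StatB.stat≤total {S = 1} {2} g (λ i → negative≤1 (lookup g i))
      (λ i j _ → +-mono-≤ (below≤1 (lookup g i) (lookup g j)) (below≤1 (neg (lookup g i)) (lookup g j))))
    (≤-reflexive (sym length-longest))

  ℓ-longest : length longest ≤ ℓ (evB w₀)
  ℓ-longest = ≤-trans (≤-reflexive length-longest) (StatB.total≤stat {S = 1} {2} (evB w₀)
    (λ i → ≤-reflexive (cong negative (sym (lookup-w₀ i))))
    λ i j i<j → subst₂ (λ x y → 2 ≤ inversionB x y) (sym (lookup-w₀ i)) (sym (lookup-w₀ j))
      (+-mono-≤ (≤-reflexive (sym (⟦⟧-yes (signed (true , j) ℤ.<? signed (true , i)) (ℤ.-<- i<j))))
                (≤-reflexive (sym (⟦⟧-yes (signed (true , j) ℤ.<? signed (false , i)) ℤ.-<+)))))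

  -- Every position below n · n belongs to one of the first n rounds and is selected, so nothing is
  -- ever skipped.
  skip : ∀ pre p r → p < M → pre ++ selectedFrom c targetB p r ≡ longest → ¬ Selected c targetB p →
    ℓ (actB (evB (subword c pre)) (cinf c p)) < ℓ (evB (subword c pre))
  skip pre p r p<M _ ¬sel = ⊥-elim (¬sel (m<n*o⇒m/o<n (subst (p <_) M≡n*n p<M)))

  open Greedy decGB c targetB M ℓ-max ℓ-longest skip using (lex-first) public

  actG-injective : ∀ t u → actG neg ε t ≡ actG neg ε u → t ≡ u
  actG-injective zero    zero    eq = refl
  actG-injective (suc t) (suc u) eq = cong suc (σ-injective t u λ i →
    cong proj₂ (trans (sym (at t i)) (trans (cong (λ w → lookup w i) eq) (at u i))))
    where
    at : ∀ t i → lookup (swapAdj ε t) i ≡ (false , σ t i)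
    at t i = trans (lookup-swapAdj ε t i) (lookup∘tabulate (false ,_) (σ t i))
  actG-injective zero (suc u) eq = ⊥-elim (positive u (cong (λ w → lookup w zero) eq))
    where
    positive : ∀ u → (true , zero) ≢ lookup (swapAdj ε u) zero
    positive u p with () ← trans p (trans (lookup-swapAdj ε u zero) (lookup∘tabulate (false ,_) (σ u zero)))
  actG-injective (suc t) zero eq = sym (actG-injective zero (suc t) (sym eq))

  -- The longest element negates every entry, and negation commutes with all generators.
  ψ-trivial : ∀ s → Coxeter.ψ evB decGB w₀ s ≡ s
  ψ-trivial s = ψ-unique evB decGB w₀ s s
    (trans (foldl-++ actB ε (reverse w₀) (s ∷ w₀)) (begin
      foldl actB (actB v s) w₀     ≡⟨ negates (actB v s) ⟩
      Vec.map neg (actB v s)       ≡⟨ cong (Vec.map neg) (actB≡actG v s) ⟩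
      Vec.map neg (actG neg v s)   ≡⟨ map-actG neg (λ _ → refl) v s ⟩
      actG neg (Vec.map neg v) s   ≡⟨ actB≡actG (Vec.map neg v) s ⟨
      actB (Vec.map neg v) s       ≡⟨ cong (λ w → actB w s) (negates v) ⟨
      actB (foldl actB v w₀) s     ≡⟨ cong (λ w → actB w s) (foldl-reverse ε w₀) ⟩
      actB ε s                     ∎))
    (λ u eq → actG-injective s u (trans (sym (actB≡actG ε s)) (trans eq (actB≡actG ε u))))
    where
    open ≡-Reasoning
    v : GB n
    v = evB (reverse w₀)

  rotation-longest : ∀ k → 1 ≤ k → ∀ ps → ps ≡ longest → (q : Fin (length (mkQ k c ps))) →
    SameSymPair (n + k)
      (φB (n + k) c (mkQ k c ps) (Coxeter.Θ evB decGB (subword c ps) (mkQ k c ps) q))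
      (rot (φB (n + k) c (mkQ k c ps) q))
  rotation-longest k 1≤k _ refl = rotates (mkQ k c longest) evB decGB w₀ (SameSymPair (n + k)) (inj₁ ∘ ≡⇒SameDiag) base
    (λ s → ≤-trans 1≤k (≤-trans (m≤m+n k _) (≤-reflexive (sym (count-Q k longest s)))))
    -- Each letter occurs k + n times, a half-turn of the polygon with 2 (n + k) vertices, which
    -- exchanges the two diagonals of a pair.
    (λ s → inj₂ (≡⇒SameDiag (cong₂ rotBy
      (trans (+-comm n k) (sym (trans (count-Q k longest s) (cong (k +_) (count-longest (toℕ s) (Finₚ.toℕ<n s))))))
      (cong base (ψ-trivial s)))))
    where
    base : Fin n → Diag
    base t = ℤ.+ ascC c t , ℤ.+ (n + k) ℤ.- ℤ.+ descC c t

  rotation : ∀ k → 1 ≤ k → ∀ ps → Coxeter.IsWoC evB decGB c ps → (q : Fin (length (mkQ k c ps))) →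
    SameSymPair (n + k)
      (φB (n + k) c (mkQ k c ps) (Coxeter.Θ evB decGB (subword c ps) (mkQ k c ps) q))
      (rot (φB (n + k) c (mkQ k c ps) q))
  rotation k 1≤k ps isWoC = rotation-longest k 1≤k ps (lex-first ps isWoC)

theorem8p10 : (∀ (k n : ℕ) .{{_ : NonZero n}} → 1 ≤ k →
    (c : Vec (Fin n) n) → (∀ i j → lookup c i ≡ lookup c j → i ≡ j) →
    (ps : List ℕ) → Coxeter.IsWoC evA decGA c ps →
    (q : Fin (length (mkQ k c ps))) →
    SameDiag (suc (n + 2 * k))
    (φA k c (mkQ k c ps) (Coxeter.Θ evA decGA (subword c ps) (mkQ k c ps) q))
    (rot (φA k c (mkQ k c ps) q)))
    ×
    (∀ (k n : ℕ) .{{_ : NonZero n}} → 1 ≤ k →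
    (c : Vec (Fin n) n) → (∀ i j → lookup c i ≡ lookup c j → i ≡ j) →
    (ps : List ℕ) → Coxeter.IsWoC evB decGB c ps →
    (q : Fin (length (mkQ k c ps))) →
    SameSymPair (n + k)
    (φB (n + k) c (mkQ k c ps) (Coxeter.Θ evB decGB (subword c ps) (mkQ k c ps) q))
    (rot (φB (n + k) c (mkQ k c ps) q)))
theorem8p10 =
  (λ { k zero {{_}} → ⊥-elim (≢-nonZero⁻¹ 0 refl)
     ; k (suc m) 1≤k c c-injective → TypeA.rotation c c-injective _ refl k 1≤k }) ,
  (λ { k zero {{_}} → ⊥-elim (≢-nonZero⁻¹ 0 refl)
     ; k (suc m) 1≤k c c-injective → TypeB.rotation c c-injective _ refl k 1≤k })
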